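{- For every integer $k\geq 3$ with $k\notin\{4,6,8,10,12\}$, $n(k|k)=c(k|k)=2k$. Moreover, $n(4|4)=c(4|4)=7$, and for $k\in\{6,8,10,12\}$, $2k-1\leq n(k|k)\leq c(k|k)\leq 2k$.
   Context: An $(r|\chi)$-graph is a simple finite $r$-regular graph with chromatic number $\chi$. $n(r|\chi)$ is the minimum order of an $(r|\chi)$-graph and $c(r|\chi)$ is the minimum order of an $(r|\chi)$-graph which is a Cayley graph. -}

module Defs where

open import Data.Nat using (ℕ; zero; suc; _+_; _*_; _∸_; _≤_; _<_)
open import Data.Fin using (Fin)
open import Data.List using (List; map; allFin)
open import Data.Nat.ListAction using (sum)
open import Data.Bool using (Bool; true; false; if_then_else_)
open import Data.Product using (Σ; _×_; ∃)
open import Relation.Nullary using (¬_)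
open import Relation.Binary.PropositionalEquality using (_≡_; _≢_)
open import Algebra.Structures using (IsGroup)

Adj : ℕ → Set
Adj n = Fin n → Fin n → Bool

record SimpleGraph (n : ℕ) : Set where
  field
    adj    : Adj n
    sym    : ∀ x y → adj x y ≡ adj y x
    irrefl : ∀ x → adj x x ≡ false

degree : {n : ℕ} → Adj n → Fin n → ℕ
degree {n} adj v = sum (map (λ w → if adj v w then 1 else 0) (allFin n))

Regular : {n : ℕ} → Adj n → ℕ → Set
Regular adj r = ∀ v → degree adj v ≡ r

ProperColouring : {n : ℕ} → Adj n → (c : ℕ) → (Fin _ → Fin c) → Set
ProperColouring {n} adj c f = ∀ x y → adj x y ≡ true → f x ≢ f y

Colourable : {n : ℕ} → Adj n → ℕ → Set
Colourable {n} adj c = Σ (Fin n → Fin c) (ProperColouring adj c)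

HasChromaticNumber : {n : ℕ} → Adj n → ℕ → Set
HasChromaticNumber adj χ = Colourable adj χ × (∀ c → c < χ → ¬ Colourable adj c)

IsRChi : {n : ℕ} → ℕ → ℕ → Adj n → Set
IsRChi r χ adj = Regular adj r × HasChromaticNumber adj χ

HasRChiGraph : ℕ → ℕ → ℕ → Set
HasRChiGraph r χ n = Σ (SimpleGraph n) (λ G → IsRChi r χ (SimpleGraph.adj G))

-- Cayley graph data on a group whose underlying set is Fin n
-- (every finite group of order n is isomorphic to one of these).
record CayleyData (n : ℕ) : Set where
  field
    _∙_     : Fin n → Fin n → Fin n
    ε       : Fin n
    _⁻¹     : Fin n → Fin n
    isGroup : IsGroup _≡_ _∙_ ε _⁻¹
    S       : Fin n → Bool
    S-ε     : S ε ≡ false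
    S-inv   : ∀ g → S (g ⁻¹) ≡ S g

  -- Cay(G,S): x ~ y iff x⁻¹ y ∈ S (simple by S-ε and S-inv)
  cayAdj : Adj n
  cayAdj x y = S ((x ⁻¹) ∙ y)

HasCayleyRChiGraph : ℕ → ℕ → ℕ → Set
HasCayleyRChiGraph r χ n = Σ (CayleyData n) (λ C → IsRChi r χ (CayleyData.cayAdj C))

IsMinimum : (ℕ → Set) → ℕ → Set
IsMinimum P m = P m × (∀ m' → m' < m → ¬ P m')

nRChi≡ : ℕ → ℕ → ℕ → Set
nRChi≡ r χ m = IsMinimum (HasRChiGraph r χ) m

cRChi≡ : ℕ → ℕ → ℕ → Set
cRChi≡ r χ m = IsMinimum (HasCayleyRChiGraph r χ) m

{-# OPTIONS --safe #-}
-- Let G be k-regular on n < 2k vertices with chromatic number k; "non-adjacent pair" means an edge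
-- of the complement H, and every partition into independent sets has at least k classes. A largest
-- matching of H leaves a partition into exactly k singletons and non-adjacent pairs. A singleton u
-- meets each other class, and as its degree is k it is adjacent to both ends of exactly one pair;
-- by augmenting paths, suitable ends of the other pairs form with the singletons a (k - 1)-clique Q.
-- If there are two singletons, counting the edges leaving Q is contradictory. If there is only one
-- (n = 2k - 1), such a count refutes Q when it is a clique, and Q can fail to be one only through a
-- 5-cycle of H all of whose vertices may serve as the singleton. If none of them lies in a triangle
-- of H, then the degree sum 5k of the cycle is too small; and a triangle u x₁ x₂ of H again yields a
-- (k - 1)-clique, refuted for k ≥ 9 by counting.
-- For k = 3, 5, 7 the order 2k - 1 contradicts the parity of the degree sum, for k = 4, 6, 8 it is
-- attained by circulants, and in the other cases the prism over K_k, of order 2k, is optimal.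

module Submission where

open import Defs
open import Algebra.Bundles using (Group)
import Algebra.Properties.Group as GroupProperties
open import Algebra.Structures using (IsGroup)
open import Data.Bool using (Bool; true; false; if_then_else_; not)
open import Data.Bool.ListAction using (any)
import Data.Bool.Properties as Bool
open import Data.Empty using (⊥; ⊥-elim)
open import Data.Fin as Fin using (Fin; toℕ; combine; remQuot)
open import Data.Fin.Properties as Fin using (toℕ<n; toℕ-injective; toℕ-fromℕ<; pigeonhole; all?; any?;
  remQuot-combine; combine-remQuot; combine-injective)
open import Data.List using (List; []; _∷_; [_]; _++_; map; concat; length; lookup; allFin)
open import Data.List.Membership.Propositional using (_∈_; find)
open import Data.List.Membership.Propositional.Properties
  using (∈-∃++; ∈-allFin; ∈-concat⁻; ∈-lookup; ∈-map⁺; ∈-map⁻; ∈-++⁺ˡ; ∈-++⁺ʳ)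
open import Data.List.Membership.Propositional.Properties.WithK using (unique∧set⇒bag)
open import Data.List.Properties
  using (map-++; length-map; length-++; concat-++; concat-map-[_]; ++-identityʳ; length-tabulate)
open import Data.List.Relation.Binary.BagAndSetEquality using (∼bag⇒↭)
open import Data.List.Relation.Binary.Permutation.Propositional as Perm
  using (_↭_; ↭-sym; ↭-trans; ↭-refl; ↭-reflexive; prep; swap)
open import Data.List.Relation.Binary.Permutation.Propositional.Properties as Perm
  using (shift; ++-commutativeMonoid; ↭-length; All-resp-↭; ∈-resp-↭; ++⁺ˡ; ++⁺ʳ)
open import Data.List.Relation.Unary.All as All using (All; []; _∷_)
import Data.List.Relation.Unary.All.Properties as All
open import Data.List.Relation.Unary.AllPairs as AllPairs using (AllPairs; []; _∷_)
import Data.List.Relation.Unary.AllPairs.Properties as AllPairs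
open import Data.List.Relation.Unary.Any as Any using (Any; here; there)
open import Data.List.Relation.Unary.Any.Properties using (lookup-index)
open import Data.List.Relation.Unary.Unique.Propositional using (Unique)
import Data.List.Relation.Unary.Unique.Propositional.Properties as Unique
open import Data.Nat
open import Data.Nat.DivMod using (_mod_; _%_; _/_; m%n<n; m%n%n≡m%n; m<n⇒m%n≡m; n%n≡0; %-distribˡ-+)
open import Data.Nat.ListAction using (sum)
open import Data.Nat.ListAction.Properties using (sum-++; sum-↭)
open import Data.Nat.Properties hiding (_≟_)
open import Data.Nat.Tactic.RingSolver using (solve-∀)
open import Data.Product using (Σ; ∃; ∃₂; _×_; _,_; proj₁; proj₂) renaming (swap to flip)
open import Data.Sum using (_⊎_; inj₁; inj₂)
open import Function using (_∘_; mk⇔)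
open import Relation.Binary.PropositionalEquality hiding ([_])
open import Relation.Nullary using (¬_; Dec; yes; no)
open import Relation.Nullary.Decidable using (from-yes; does; _×-dec_; _→-dec_; ¬?)


private variable
  A B : Set

-- Lists up to permutation

module PermSolver {A : Set} where
  open import Algebra.Solver.CommutativeMonoid (++-commutativeMonoid {A = A}) public
    using (solve; _⊕_; _⊜_)

∈⇒↭ : {x : A} {xs : List A} → x ∈ xs → ∃ λ ys → xs ↭ x ∷ ys
∈⇒↭ x∈xs with ys , zs , refl ← ∈-∃++ x∈xs = ys ++ zs , shift _ ys zs

-- Membership becomes a permutation that brings the element to the front, so that lemmas about the
-- first pair or singleton of a partition apply to every one.
all-↭ : {P : A → Set} (xs : List A) → (∀ {x ys} → xs ↭ x ∷ ys → P x) → All P xs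
all-↭ xs h = All.tabulate λ x∈xs → h (proj₂ (∈⇒↭ x∈xs))

allPairs-↭ : {R : A → A → Set} (xs : List A) → (∀ {x y zs} → xs ↭ x ∷ y ∷ zs → R x y) → AllPairs R xs
allPairs-↭ []       h = []
allPairs-↭ (x ∷ xs) h =
  all-↭ xs (λ p → h (prep x p)) ∷
  allPairs-↭ xs (λ p → h (↭-trans (prep x p)
    (PermSolver.solve 4 (λ a b c zs → (a ⊕ b ⊕ c ⊕ zs) ⊜ (b ⊕ c ⊕ a ⊕ zs)) ↭-refl [ x ] [ _ ] [ _ ] _)))
  where open PermSolver

-- Finite sums over lists

∑ : (A → ℕ) → List A → ℕ
∑ f xs = sum (map f xs)

∑-++ : (f : A → ℕ) (xs ys : List A) → ∑ f (xs ++ ys) ≡ ∑ f xs + ∑ f ys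
∑-++ f xs ys = trans (cong sum (map-++ f xs ys)) (sum-++ (map f xs) (map f ys))

∑-↭ : (f : A → ℕ) {xs ys : List A} → xs ↭ ys → ∑ f xs ≡ ∑ f ys
∑-↭ f p = sum-↭ (Perm.map⁺ f p)

∑-mono : {f g : A → ℕ} {xs : List A} → All (λ x → f x ≤ g x) xs → ∑ f xs ≤ ∑ g xs
∑-mono []       = z≤n
∑-mono (p ∷ ps) = +-mono-≤ p (∑-mono ps)

∑-cong : {f g : A → ℕ} {xs : List A} → All (λ x → f x ≡ g x) xs → ∑ f xs ≡ ∑ g xs
∑-cong []       = refl
∑-cong (p ∷ ps) = cong₂ _+_ p (∑-cong ps)

∑-const : (c : ℕ) (xs : List A) → ∑ (λ _ → c) xs ≡ length xs * c
∑-const c []       = refl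
∑-const c (x ∷ xs) = cong (c +_) (∑-const c xs)

∑-+ : (f g : A → ℕ) (xs : List A) → ∑ (λ x → f x + g x) xs ≡ ∑ f xs + ∑ g xs
∑-+ f g []       = refl
∑-+ f g (x ∷ xs) = trans (cong (f x + g x +_) (∑-+ f g xs)) (lemma (f x) (g x) (∑ f xs) (∑ g xs))
  where
  lemma : ∀ a b c d → a + b + (c + d) ≡ a + c + (b + d)
  lemma = solve-∀

∑-map : (f : B → ℕ) (h : A → B) (xs : List A) → ∑ f (map h xs) ≡ ∑ (f ∘ h) xs
∑-map f h []       = refl
∑-map f h (x ∷ xs) = cong (f (h x) +_) (∑-map f h xs)

∑-swap : (h : A → B → ℕ) (xs : List A) (ys : List B) →
         ∑ (λ x → ∑ (h x) ys) xs ≡ ∑ (λ y → ∑ (λ x → h x y) xs) ys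
∑-swap h []       ys = sym (trans (∑-const 0 ys) (*-zeroʳ (length ys)))
∑-swap h (x ∷ xs) ys = trans (cong (∑ (h x) ys +_) (∑-swap h xs ys))
                             (sym (∑-+ (h x) (λ y → ∑ (λ x → h x y) xs) ys))

∑-≥ : {f : A → ℕ} (c : ℕ) {xs : List A} → All (λ x → c ≤ f x) xs → length xs * c ≤ ∑ f xs
∑-≥ {f = f} c {xs} h = subst (_≤ ∑ f xs) (∑-const c xs) (∑-mono h)

∑-≤ : {f : A → ℕ} (c : ℕ) {xs : List A} → All (λ x → f x ≤ c) xs → ∑ f xs ≤ length xs * c
∑-≤ {f = f} c {xs} h = subst (∑ f xs ≤_) (∑-const c xs) (∑-mono h)

-- Lists of pairs and their orientation

Pair : Set → Set
Pair A = A × A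

flat : List (Pair A) → List A
flat ps = concat (map (λ p → proj₁ p ∷ proj₂ p ∷ []) ps)

flat-↭ : {ps qs : List (Pair A)} → ps ↭ qs → flat ps ↭ flat qs
flat-↭ Perm.refl          = ↭-refl
flat-↭ (prep p r)         = prep _ (prep _ (flat-↭ r))
flat-↭ (swap (a , b) (c , d) r) = ↭-trans
  (PermSolver.solve 5 (λ a b c d z → (a ⊕ b ⊕ c ⊕ d ⊕ z) ⊜ (c ⊕ d ⊕ a ⊕ b ⊕ z)) ↭-refl
    [ a ] [ b ] [ c ] [ d ] _)
  (prep c (prep d (prep a (prep b (flat-↭ r)))))
  where open PermSolver
flat-↭ (Perm.trans r s)   = ↭-trans (flat-↭ r) (flat-↭ s)

flat-split : (ps : List (Pair A)) → flat ps ↭ map proj₁ ps ++ map proj₂ ps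
flat-split []             = ↭-refl
flat-split ((x , y) ∷ ps) = prep x (↭-trans (prep y (flat-split ps))
  (↭-sym (shift y (map proj₁ ps) (map proj₂ ps))))

∑-flat : (f : A → ℕ) (ps : List (Pair A)) → ∑ f (flat ps) ≡ ∑ (λ p → f (proj₁ p) + f (proj₂ p)) ps
∑-flat f []             = refl
∑-flat f ((x , y) ∷ ps) = trans (cong (λ t → f x + (f y + t)) (∑-flat f ps)) (sym (+-assoc (f x) (f y) _))

all-flat : {P : A → Set} {ps : List (Pair A)} → All (λ p → P (proj₁ p) × P (proj₂ p)) ps → All P (flat ps)
all-flat []             = []
all-flat ((h , h′) ∷ a) = h ∷ h′ ∷ all-flat a

length-flat : (ps : List (Pair A)) → length (flat ps) ≡ length ps + length ps
length-flat []       = refl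
length-flat (p ∷ ps) = cong suc (trans (cong suc (length-flat ps)) (sym (+-suc (length ps) (length ps))))

-- A non-adjacent pair has no preferred order; reversing some of the pairs only permutes the
-- flattened list, so a partition survives the choice.
orient : {P : Pair A → Set} (ps : List (Pair A)) → All (λ p → P p ⊎ P (flip p)) ps →
         ∃ λ qs → flat ps ↭ flat qs × length ps ≡ length qs × All P qs
orient []       []       = [] , ↭-refl , refl , []
orient (p ∷ ps) (h ∷ hs) with qs , r , l , g ← orient ps hs | h
... | inj₁ c = p ∷ qs , prep _ (prep _ r) , cong suc l , c ∷ g
... | inj₂ c = flip p ∷ qs , swap _ _ r , cong suc l , c ∷ g

lin : ∀ {a b x y} c → a ≤ b → a ≡ x + c → b ≡ y + c → x ≤ y
lin {x = x} {y} c h refl refl = +-cancelʳ-≤ c x y h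

lin-⊥ : ∀ {a b} e → a ≤ b → a ≡ suc (e + b) → ⊥
lin-⊥ {b = b} e h refl = <⇒≱ (s≤s (m≤n+m b e)) h

-- Regular graphs and edge counts

module Graph {n : ℕ} (g : Adj n)
  (g-sym : ∀ x y → g x y ≡ g y x) (g-irr : ∀ x → g x x ≡ false)
  (k : ℕ) (reg : Regular g k)
  -- The chromatic number enters through these two bounds: the classes of a partition serve as
  -- colours, and the vertices of a clique need different colours.
  (partition≥k : ∀ (cs : List (List (Fin n))) → concat cs ↭ allFin n →
                 All (AllPairs λ x y → g x y ≡ false) cs → k ≤ length cs)
  (clique≤k : ∀ Q → AllPairs (λ x y → g x y ≡ true) Q → length Q ≤ k)
  where

  V₀ : List (Fin n)
  V₀ = allFin n

  infix 4 _~_ _≁_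
  _~_ _≁_ : Fin n → Fin n → Set
  x ~ y = g x y ≡ true
  x ≁ y = g x y ≡ false

  ~-sym : ∀ {x y} → x ~ y → y ~ x
  ~-sym {x} {y} e = trans (g-sym y x) e

  ≁-sym : ∀ {x y} → x ≁ y → y ≁ x
  ≁-sym {x} {y} e = trans (g-sym y x) e

  force~ : ∀ {x y} → ¬ (x ≁ y) → x ~ y
  force~ {x} {y} h with g x y
  ... | true  = refl
  ... | false = ⊥-elim (h refl)

  force≁ : ∀ {x y} → ¬ (x ~ y) → x ≁ y
  force≁ {x} {y} h with g x y
  ... | false = refl
  ... | true  = ⊥-elim (h refl)

  ~? : ∀ x y → x ~ y ⊎ x ≁ y
  ~? x y with g x y
  ... | true  = inj₁ refl
  ... | false = inj₂ refl

  ⟦_,_⟧ : Fin n → Fin n → ℕ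
  ⟦ x , y ⟧ = if g x y then 1 else 0

  ⟦⟧-sym : ∀ x y → ⟦ x , y ⟧ ≡ ⟦ y , x ⟧
  ⟦⟧-sym x y rewrite g-sym x y = refl

  ⟦⟧-irr : ∀ x → ⟦ x , x ⟧ ≡ 0
  ⟦⟧-irr x rewrite g-irr x = refl

  ~⇒1 : ∀ {x y} → x ~ y → ⟦ x , y ⟧ ≡ 1
  ~⇒1 p rewrite p = refl

  ≁⇒0 : ∀ {x y} → x ≁ y → ⟦ x , y ⟧ ≡ 0
  ≁⇒0 p rewrite p = refl

  ~⇒≥1 : ∀ {x y} → x ~ y → 1 ≤ ⟦ x , y ⟧
  ~⇒≥1 p rewrite p = ≤-refl

  ⟦⟧≤1 : ∀ x y → ⟦ x , y ⟧ ≤ 1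
  ⟦⟧≤1 x y with g x y
  ... | true  = ≤-refl
  ... | false = z≤n

  one≥1 : ∀ {x y z w} → (x ≁ y → z ≁ w → ⊥) → 1 ≤ ⟦ x , y ⟧ + ⟦ z , w ⟧
  one≥1 {x} {y} {z} {w} h with g x y | g z w
  ... | true  | _     = s≤s z≤n
  ... | false | true  = ≤-refl
  ... | false | false = ⊥-elim (h refl refl)

  one≤1 : ∀ {x y z w} → (x ~ y → z ~ w → ⊥) → ⟦ x , y ⟧ + ⟦ z , w ⟧ ≤ 1
  one≤1 {x} {y} {z} {w} h with g x y | g z w
  ... | true  | true  = ⊥-elim (h refl refl)
  ... | true  | false = ≤-refl
  ... | false | true  = ≤-refl
  ... | false | false = z≤n

  both : ∀ {x y z w} → x ~ y → z ~ w → 2 ≤ ⟦ x , y ⟧ + ⟦ z , w ⟧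
  both p q rewrite p | q = ≤-refl

  -- E A B counts the edges from A to B, those inside A ∩ B twice.
  E : List (Fin n) → List (Fin n) → ℕ
  E A B = ∑ (λ a → ∑ ⟦ a ,_⟧ B) A

  E-++ˡ : ∀ A B C → E (A ++ B) C ≡ E A C + E B C
  E-++ˡ A B C = ∑-++ _ A B

  E-++ʳ : ∀ A B C → E A (B ++ C) ≡ E A B + E A C
  E-++ʳ A B C = trans (∑-cong (All.universal (λ a → ∑-++ ⟦ a ,_⟧ B C) A)) (∑-+ _ _ A)

  E-sym : ∀ A B → E A B ≡ E B A
  E-sym A B = trans (∑-swap ⟦_,_⟧ A B)
    (∑-cong (All.universal (λ b → ∑-cong (All.universal (λ a → ⟦⟧-sym a b) A)) B))

  E-≤ : ∀ A B → E A B ≤ length A * length B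
  E-≤ A B = ∑-≤ (length B) (All.universal (λ a → subst (∑ ⟦ a ,_⟧ B ≤_) (*-identityʳ _)
    (∑-≤ 1 (All.universal (⟦⟧≤1 a) B))) A)

  ∑-self-∷ : ∀ x A → E (x ∷ A) (x ∷ A) ≡ ∑ ⟦ x ,_⟧ A + ∑ ⟦ x ,_⟧ A + E A A
  ∑-self-∷ x A = trans (cong₂ _+_ (cong (_+ ∑ ⟦ x ,_⟧ A) (⟦⟧-irr x)) (trans (∑-+ _ _ A)
      (cong (_+ E A A) (∑-cong (All.universal (λ a → ⟦⟧-sym a x) A)))))
    (sym (+-assoc (∑ ⟦ x ,_⟧ A) _ _))

  ∑-≤-length : ∀ x A → ∑ ⟦ x ,_⟧ A ≤ length A
  ∑-≤-length x A = subst (∑ ⟦ x ,_⟧ A ≤_) (*-identityʳ _) (∑-≤ 1 (All.universal (⟦⟧≤1 x) A))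

  ∑-≡-length : ∀ {x A} → All (x ~_) A → ∑ ⟦ x ,_⟧ A ≡ length A
  ∑-≡-length {A = A} h = trans (∑-cong (All.map ~⇒1 h)) (trans (∑-const 1 A) (*-identityʳ _))

  -- The diagonal contributes nothing, which saves one per entry; `length A` stands on the left to
  -- avoid truncated subtraction.
  E-self : ∀ A → E A A + length A ≤ length A * length A
  E-self []      = z≤n
  E-self (x ∷ A) rewrite ∑-self-∷ x A = lin 0
    (s≤s (+-mono-≤ (+-mono-≤ (∑-≤-length x A) (∑-≤-length x A)) (E-self A)))
    (eq₁ (∑ ⟦ x ,_⟧ A) (E A A) (length A)) (eq₂ (length A)) where
    eq₁ : ∀ s e a → suc (s + s + (e + a)) ≡ s + s + e + suc a + 0
    eq₁ = solve-∀
    eq₂ : ∀ a → suc (a + a + a * a) ≡ suc a * suc a + 0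
    eq₂ = solve-∀

  E-clique : ∀ {A} → AllPairs _~_ A → E A A + length A ≡ length A * length A
  E-clique []      = refl
  E-clique {x ∷ A} (h ∷ hs) rewrite ∑-self-∷ x A | ∑-≡-length h =
    trans (eq₁ (length A) (E A A)) (trans (cong (λ t → suc (length A + length A + t)) (E-clique hs)) (eq₂ (length A))) where
    eq₁ : ∀ a e → a + a + e + suc a ≡ suc (a + a + (e + a))
    eq₁ = solve-∀
    eq₂ : ∀ a → suc (a + a + a * a) ≡ suc a * suc a
    eq₂ = solve-∀

  degree-↭ : ∀ {xs} → xs ↭ V₀ → ∀ v → ∑ ⟦ v ,_⟧ xs ≡ k
  degree-↭ p v = trans (∑-↭ ⟦ v ,_⟧ p) (reg v)

  E-degree : ∀ A {xs} → xs ↭ V₀ → E A xs ≡ length A * k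
  E-degree A p = trans (∑-cong (All.universal (degree-↭ p) A)) (∑-const k A)

  -- Handshake argument: prepending a vertex counts each edge from it to the others twice.
  E-even : ∀ A → ∃ λ d → E A A ≡ d + d
  E-even []      = 0 , refl
  E-even (x ∷ A) with d , eq ← E-even A = ∑ ⟦ x ,_⟧ A + d ,
    trans (∑-self-∷ x A) (trans (cong (∑ ⟦ x ,_⟧ A + ∑ ⟦ x ,_⟧ A +_) eq) (interchange (∑ ⟦ x ,_⟧ A) d)) where
    interchange : ∀ s d → s + s + (d + d) ≡ s + d + (s + d)
    interchange = solve-∀

  degree-sum-even : ∃ λ d → n * k ≡ d + d
  degree-sum-even with d , eq ← E-even V₀ =
    d , trans (sym (trans (E-degree V₀ ↭-refl) (cong (_* k) (length-tabulate {n = n} (λ x → x))))) eq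

  -- Each vertex of `Q` has k - 2 neighbours inside `Q` and degree k, hence exactly two neighbours
  -- outside.
  E-clique-rest : ∀ {Q R} → Q ++ R ↭ V₀ → AllPairs _~_ Q → k ≡ suc (length Q) → E R Q ≡ length Q + length Q
  E-clique-rest {Q} {R} p c eq = trans (E-sym R Q) (+-cancelˡ-≡ (q * q) _ _ (begin
    q * q + E Q R             ≡⟨ cong (_+ E Q R) (sym (E-clique c)) ⟩
    E Q Q + q + E Q R         ≡⟨ eq₁ (E Q Q) q (E Q R) ⟩
    (E Q Q + E Q R) + q       ≡⟨ cong (_+ q) (trans (sym (E-++ʳ Q Q R)) (E-degree Q p)) ⟩
    q * k + q                 ≡⟨ cong (λ t → q * t + q) eq ⟩
    q * suc q + q             ≡⟨ eq₂ q ⟩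
    q * q + (q + q)           ∎)) where
    open ≡-Reasoning
    q = length Q
    eq₁ : ∀ a q b → a + q + b ≡ a + b + q
    eq₁ = solve-∀
    eq₂ : ∀ q → q * suc q + q ≡ q * q + (q + q)
    eq₂ = solve-∀

  -- Partitions into singletons and non-adjacent pairs

  Nonadj : Pair (Fin n) → Set
  Nonadj (x , y) = x ≁ y

  degPair : Fin n → Pair (Fin n) → ℕ
  degPair v (x , y) = ⟦ v , x ⟧ + ⟦ v , y ⟧

  -- A matching `ps` of the complement with its unmatched vertices `U`; fewer classes `j` mean a
  -- larger matching.
  record Part (j : ℕ) (U : List (Fin n)) (ps : List (Pair (Fin n))) : Set where
    constructor part
    field
      perm : U ++ flat ps ↭ V₀
      non  : All Nonadj ps
      size : length U + length ps ≡ j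

  part-singles : ∀ {j U U′ ps} → U ↭ U′ → Part j U ps → Part j U′ ps
  part-singles {ps = ps} r (part p nn s) =
    part (↭-trans (++⁺ʳ (flat ps) (↭-sym r)) p) nn (trans (cong (_+ length ps) (sym (↭-length r))) s)

  part-flat : ∀ {j U ps qs} → flat ps ↭ flat qs → length ps ≡ length qs → All Nonadj qs →
              Part j U ps → Part j U qs
  part-flat {U = U} r l nn (part p _ s) =
    part (↭-trans (++⁺ˡ U (↭-sym r)) p) nn (trans (cong (length U +_) (sym l)) s)

  part-pairs : ∀ {j U ps qs} → ps ↭ qs → Part j U ps → Part j U qs
  part-pairs r h = part-flat (flat-↭ r) (↭-length r) (All-resp-↭ r (Part.non h)) h

  part-flip : ∀ {j U x y ps} → Part j U ((x , y) ∷ ps) → Part j U ((y , x) ∷ ps)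
  part-flip h@(part _ (e ∷ nn) _) = part-flat (swap _ _ ↭-refl) refl (≁-sym e ∷ nn) h

  part-degree : ∀ {j U ps} → Part j U ps → ∀ v → ∑ ⟦ v ,_⟧ U + ∑ (degPair v) ps ≡ k
  part-degree {U = U} {ps} (part p _ _) v =
    trans (cong (∑ ⟦ v ,_⟧ U +_) (sym (∑-flat ⟦ v ,_⟧ ps)))
      (trans (sym (∑-++ ⟦ v ,_⟧ U (flat ps))) (degree-↭ p v))

  part-order : ∀ {j U ps} → Part j U ps → length U + (length ps + length ps) ≡ n
  part-order {U = U} {ps} (part p _ _) =
    trans (cong (length U +_) (sym (length-flat ps)))
      (trans (sym (length-++ U)) (trans (↭-length p) (length-tabulate _)))

  mates : List (Pair (Fin n)) → List (Fin n)
  mates = map proj₂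

  hubs : List (Pair (Fin n)) → List (Fin n)
  hubs = map proj₁

  -- The form in which every exchange argument ends; `cs` leaves room for independent sets of three
  -- vertices.
  too-few : ∀ cs U ps → concat cs ++ U ++ flat ps ↭ V₀ → All (AllPairs _≁_) cs → All Nonadj ps →
            length cs + (length U + length ps) < k → ⊥
  too-few cs U ps p ics ips lt = <⇒≱ lt (subst (k ≤_) len
    (partition≥k (cs ++ map [_] U ++ map pair ps) (↭-trans (↭-reflexive flatten) p) ind)) where
    pair : Pair (Fin n) → List (Fin n)
    pair (x , y) = x ∷ y ∷ []
    flatten : concat (cs ++ map [_] U ++ map pair ps) ≡ concat cs ++ U ++ flat ps
    flatten = trans (sym (concat-++ cs _)) (cong (concat cs ++_)
      (trans (sym (concat-++ (map [_] U) _)) (cong (_++ flat ps) (concat-map-[_] U))))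
    len : length (cs ++ map [_] U ++ map pair ps) ≡ length cs + (length U + length ps)
    len = trans (length-++ cs) (cong (length cs +_)
      (trans (length-++ (map [_] U)) (cong₂ _+_ (length-map [_] U) (length-map pair ps))))
    ind : All (AllPairs _≁_) (cs ++ map [_] U ++ map pair ps)
    ind = All.++⁺ ics (All.++⁺ (All.map⁺ (All.universal (λ _ → [] ∷ []) U))
      (All.map⁺ (All.map (λ e → (e ∷ []) ∷ [] ∷ []) ips)))

  open PermSolver

  -- Only adjacency between two second ends is left to prove, and the last hypothesis offers their
  -- pairs at the head of `ps`, where the exchange lemmas apply.
  mates-clique : ∀ {U ps} → AllPairs _~_ U → All (λ p → All (_~ proj₂ p) U) ps →
                 (∀ {x y x′ y′ qs} → ps ↭ (x , y) ∷ (x′ , y′) ∷ qs →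
                   All (_~ y) U → All (_~ y′) U → y ~ y′) →
                 AllPairs _~_ (U ++ mates ps)
  mates-clique {ps = ps} cU good h = AllPairs.++⁺ cU
    (AllPairs.map⁺ (allPairs-↭ ps λ r → let gs = All-resp-↭ r good in h r (All.head gs) (All.head (All.tail gs))))
    (All.tabulate λ u∈U → All.map⁺ (All.map (λ a → All.lookup a u∈U) good))

  orient-part : ∀ {j} (U₀ : List (Fin n)) {U ps} → Part j U ps →
                (∀ {x y qs} → ps ↭ (x , y) ∷ qs → All (_~ y) U₀ ⊎ All (_~ x) U₀) →
                ∃ λ qs → flat ps ↭ flat qs × length ps ≡ length qs × Part j U qs ×
                         All (λ p → All (_~ proj₂ p) U₀) qs
  orient-part U₀ {ps = ps} P h = finish (orient ps (all-↭ ps half)) where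
    Good : Pair (Fin n) → Set
    Good p = Nonadj p × All (_~ proj₂ p) U₀
    half : ∀ {p qs} → ps ↭ p ∷ qs → Good p ⊎ Good (flip p)
    half r with All-resp-↭ r (Part.non P) | h r
    ... | e ∷ _ | inj₁ a = inj₁ (e , a)
    ... | e ∷ _ | inj₂ a = inj₂ (≁-sym e , a)
    finish : (∃ λ qs → flat ps ↭ flat qs × length ps ≡ length qs × All Good qs) → _
    finish (qs , r , l , a) = qs , r , l , part-flat r l (All.map proj₁ a) P , All.map proj₂ a

  some-end : ∀ {U x y} → (∀ {w U′} → U ↭ w ∷ U′ → w ≁ y → All (_~ x) (w ∷ U′)) →
             All (_~ y) U ⊎ All (_~ x) U
  some-end {U} {x} {y} h with All.all? (λ w → g w y Bool.≟ true) U
  ... | yes a = inj₁ a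
  ... | no ¬a with w , w∈U , w≁y ← find (All.¬All⇒Any¬ (λ w → g w y Bool.≟ true) U ¬a)
              with U′ , r ← ∈⇒↭ w∈U = inj₂ (All-resp-↭ (↭-sym r) (h r (force≁ w≁y)))

  -- Augmenting a matching of the complement

  Unsplittable : ℕ → Set
  Unsplittable j = ∀ {U ps} → Part j U ps → ⊥

  -- The pairs form a matching of the complement; with j + 1 > k classes it can be augmented, since
  -- otherwise the singletons and one end of each pair would be a clique on more than k vertices.
  augment : ∀ {j} → n < k + k → k ≤ j → Unsplittable j → Unsplittable (suc j)
  augment {j} n<2k k≤j bad = main where
    P = Part (suc j)

    swap₂ : ∀ {u v U ps} → P (u ∷ v ∷ U) ps → P (v ∷ u ∷ U) ps
    swap₂ = part-singles (swap _ _ ↭-refl)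

    size₁ : ∀ a b → suc (a + suc b) ≡ suc (suc (a + b))
    size₁ = solve-∀

    singles~ : ∀ {u v U ps} → P (u ∷ v ∷ U) ps → u ~ v
    singles~ {u} {v} {U} {ps} (part p nn s) = force~ λ e → bad (part
      (↭-trans (solve 4 (λ u v U F → (U ⊕ u ⊕ v ⊕ F) ⊜ (u ⊕ v ⊕ U ⊕ F)) ↭-refl [ u ] [ v ] U (flat ps)) p)
      (e ∷ nn) (suc-injective (trans (size₁ (length U) (length ps)) s)))

    -- Otherwise u x y v is an augmenting path of the complement.
    cross : ∀ {u v U x y ps} → P (u ∷ v ∷ U) ((x , y) ∷ ps) → u ≁ x → v ≁ y → ⊥
    cross {u} {v} {U} {x} {y} {ps} (part p (_ ∷ nn) s) e e′ = bad (part
      (↭-trans (solve 6 (λ u v U x y F → (U ⊕ u ⊕ x ⊕ v ⊕ y ⊕ F) ⊜ (u ⊕ v ⊕ U ⊕ x ⊕ y ⊕ F)) ↭-refl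
        [ u ] [ v ] U [ x ] [ y ] (flat ps)) p)
      (e ∷ e′ ∷ nn) (suc-injective (trans (size₁ (length U) (suc (length ps))) s)))

    -- The augmenting path is u x y y′ x′ v.
    cross₂ : ∀ {u v U x y x′ y′ ps} → P (u ∷ v ∷ U) ((x , y) ∷ (x′ , y′) ∷ ps) →
             u ≁ x → v ≁ x′ → y ≁ y′ → ⊥
    cross₂ {u} {v} {U} {x} {y} {x′} {y′} {ps} (part p (_ ∷ _ ∷ nn) s) e e′ e″ = bad (part
      (↭-trans (solve 8 (λ u v U x y x′ y′ F → (U ⊕ u ⊕ x ⊕ v ⊕ x′ ⊕ y ⊕ y′ ⊕ F) ⊜
                                               (u ⊕ v ⊕ U ⊕ x ⊕ y ⊕ x′ ⊕ y′ ⊕ F)) ↭-refl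
        [ u ] [ v ] U [ x ] [ y ] [ x′ ] [ y′ ] (flat ps)) p)
      (e ∷ e′ ∷ e″ ∷ nn) (suc-injective (trans (size₁ (length U) (suc (suc (length ps)))) s)))

    degPair-sum : ∀ {u v U ps} → P (u ∷ v ∷ U) ps →
                  suc (length U) + suc (length U) + ∑ (λ p → degPair u p + degPair v p) ps ≡ k + k
    degPair-sum {u} {v} {U} {ps} h = begin
      m + m + ∑ (λ p → degPair u p + degPair v p) ps       ≡⟨ cong (m + m +_) (∑-+ (degPair u) (degPair v) ps) ⟩
      m + m + (∑ (degPair u) ps + ∑ (degPair v) ps)        ≡⟨ eq m _ _ ⟩
      (m + ∑ (degPair u) ps) + (m + ∑ (degPair v) ps)      ≡⟨ cong₂ _+_ (one h) (one (swap₂ h)) ⟩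
      k + k                                                ∎ where
      open ≡-Reasoning
      m = suc (length U)
      eq : ∀ m a b → m + m + (a + b) ≡ (m + a) + (m + b)
      eq = solve-∀
      one : ∀ {u v} → P (u ∷ v ∷ U) ps → suc (length U) + ∑ (degPair u) ps ≡ k
      one {u} {v} h = trans (cong (_+ ∑ (degPair u) ps)
        (sym (cong₂ _+_ (⟦⟧-irr u) (∑-≡-length {u} {v ∷ U} (all-↭ (v ∷ U) λ r → singles~ (part-singles (prep u r) h))))))
        (part-degree h u)

    pair≥2 : ∀ {u v U x y ps} → P (u ∷ v ∷ U) ((x , y) ∷ ps) → 2 ≤ degPair u (x , y) + degPair v (x , y)
    pair≥2 {u} {v} {x = x} {y} h = subst (2 ≤_) (eq ⟦ u , x ⟧ ⟦ v , y ⟧ ⟦ u , y ⟧ ⟦ v , x ⟧)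
      (+-mono-≤ (one≥1 (cross h)) (one≥1 (cross (part-flip h)))) where
      eq : ∀ a b c d → a + b + (c + d) ≡ a + c + (d + b)
      eq = solve-∀

    -- Since k ≤ j, `degPair-sum` leaves at most two edges per pair on average, and by `pair≥2` no
    -- pair lies below that average.
    pair≤2 : ∀ {u v U x y ps} → P (u ∷ v ∷ U) ((x , y) ∷ ps) → degPair u (x , y) + degPair v (x , y) ≤ 2
    pair≤2 {u} {v} {U} {x} {y} {ps} h = +-cancelʳ-≤ (suc a + suc a + b * 2) d 2 (begin
      d + (suc a + suc a + b * 2)   ≤⟨ +-monoʳ-≤ d (+-monoʳ-≤ (suc a + suc a) rest) ⟩
      d + (suc a + suc a + r)       ≡⟨ eq₁ d (suc a + suc a) r ⟩
      suc a + suc a + (d + r)       ≡⟨ degPair-sum h ⟩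
      k + k                         ≤⟨ +-mono-≤ k≤j k≤j ⟩
      j + j                         ≡⟨ cong (λ t → t + t) (trans (suc-injective (sym (Part.size h))) (+-suc (suc a) b)) ⟩
      suc (suc a + b) + suc (suc a + b)  ≡⟨ eq₂ a b ⟩
      2 + (suc a + suc a + b * 2)   ∎) where
      open ≤-Reasoning
      a = length U
      b = length ps
      d = degPair u (x , y) + degPair v (x , y)
      r = ∑ (λ p → degPair u p + degPair v p) ps
      rest : b * 2 ≤ r
      rest = ∑-≥ 2 (all-↭ ps λ q → pair≥2 (part-pairs (↭-trans (prep _ q) (swap _ _ ↭-refl)) h))
      eq₁ : ∀ d m r → d + (m + r) ≡ m + (d + r)
      eq₁ = solve-∀
      eq₂ : ∀ a b → suc (suc a + b) + suc (suc a + b) ≡ 2 + (suc a + suc a + b * 2)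
      eq₂ = solve-∀

    opposite : ∀ {u v U x y ps} → P (u ∷ v ∷ U) ((x , y) ∷ ps) → u ~ y → v ~ y → u ≁ x
    opposite {u} {v} {x = x} {y} h uy vy = force≁ λ ux →
      1+n≰n (≤-trans (+-mono-≤ (both ux uy) (≤-trans (~⇒≥1 vy) (m≤n+m ⟦ v , y ⟧ ⟦ v , x ⟧))) (pair≤2 h))

    -- Each pair covers two vertices, so the number of singletons is 2(j + 1) - n, while n ≤ 2k - 1
    -- ≤ 2j - 1.
    three-singles : ∀ {U ps} → P U ps → 3 ≤ length U
    three-singles {U} {ps} h = +-cancelʳ-≤ (b + b + a) 3 a (begin
      3 + (b + b + a)             ≡⟨ eq₁ a b ⟩
      suc (a + (b + b)) + 2       ≡⟨ cong (λ t → suc t + 2) (part-order h) ⟩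
      suc n + 2                   ≤⟨ +-monoˡ-≤ 2 n<2k ⟩
      k + k + 2                   ≤⟨ +-monoˡ-≤ 2 (+-mono-≤ k≤j k≤j) ⟩
      j + j + 2                   ≡⟨ eq₂ j ⟩
      suc j + suc j               ≡⟨ cong (λ t → t + t) (sym (Part.size h)) ⟩
      a + b + (a + b)             ≡⟨ eq₃ a b ⟩
      a + (b + b + a)             ∎) where
      open ≤-Reasoning
      a = length U
      b = length ps
      eq₁ : ∀ a b → 3 + (b + b + a) ≡ suc (a + (b + b)) + 2
      eq₁ = solve-∀
      eq₂ : ∀ j → j + j + 2 ≡ suc j + suc j
      eq₂ = solve-∀
      eq₃ : ∀ a b → a + b + (a + b) ≡ a + (b + b + a)
      eq₃ = solve-∀

    -- If `w` missed both ends, `cross` would make every other singleton adjacent to both; two of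
    -- these send four edges to the pair, against `pair≤2`.
    other-end : ∀ {w U x y ps} → 3 ≤ suc (length U) → P (w ∷ U) ((x , y) ∷ ps) → w ≁ y → All (_~ x) (w ∷ U)
    other-end {w} {U@(v ∷ v′ ∷ U′)} {x} {y} _ h wy =
      (force~ λ wx → 1+n≰n (≤-trans (n≤1+n 3) (≤-trans
        (+-mono-≤ (both (~x ↭-refl) (~y wx ↭-refl)) (both (~x (swap _ _ ↭-refl)) (~y wx (swap _ _ ↭-refl))))
        (pair≤2 (part-singles (rotate w) h))))) ∷ all-↭ U ~x
      where
      rotate : ∀ w → w ∷ v ∷ v′ ∷ U′ ↭ v ∷ v′ ∷ w ∷ U′
      rotate w = solve 4 (λ a b c d → (a ⊕ b ⊕ c ⊕ d) ⊜ (b ⊕ c ⊕ a ⊕ d)) ↭-refl [ w ] [ v ] [ v′ ] U′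
      ~x : ∀ {z zs} → U ↭ z ∷ zs → z ~ x
      ~x r = force~ λ zx → cross (part-singles (prep w r) (part-flip h)) wy zx
      ~y : w ≁ x → ∀ {z zs} → U ↭ z ∷ zs → z ~ y
      ~y wx r = force~ λ zy → cross (part-singles (prep w r) h) wx zy
    other-end {U = []}    (s≤s ()) _ _
    other-end {U = _ ∷ []} (s≤s (s≤s ())) _ _

    -- By `opposite`, u ≁ x and v ≁ x′, so y ≁ y′ would complete the path forbidden by `cross₂`.
    meet : ∀ {u v U x y x′ y′ qs} → P (u ∷ v ∷ U) ((x , y) ∷ (x′ , y′) ∷ qs) →
           All (_~ y) (u ∷ v ∷ U) → All (_~ y′) (u ∷ v ∷ U) → y ~ y′
    meet h (uy ∷ vy ∷ _) (uy′ ∷ vy′ ∷ _) = force~ λ yy′ →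
      cross₂ h (opposite h uy vy) (opposite (swap₂ (part-pairs (swap _ _ ↭-refl) h)) vy′ uy′) yy′

    big-clique : ∀ {u v U qs} → P (u ∷ v ∷ U) qs → All (λ p → All (_~ proj₂ p) (u ∷ v ∷ U)) qs → ⊥
    big-clique {u} {v} {U} {qs} h good = <⇒≱ (s≤s k≤j) (≤-trans (≤-reflexive (sym (trans
        (length-++ (u ∷ v ∷ U)) (trans (cong (2 + length U +_) (length-map proj₂ qs)) (Part.size h)))))
      (clique≤k _ (mates-clique (allPairs-↭ (u ∷ v ∷ U) λ r → singles~ (part-singles r h)) good
        λ r → meet (part-pairs r h))))

    main : Unsplittable (suc j)
    main {U} {ps} h = by-size U h (three-singles h) where
      by-size : ∀ U → P U ps → 3 ≤ length U → ⊥
      by-size (_ ∷ [])     _ (s≤s ())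
      by-size U@(_ ∷ _ ∷ _) h l = big-clique (proj₁ (proj₂ (proj₂ (proj₂ o)))) (proj₂ (proj₂ (proj₂ (proj₂ o)))) where
        o = orient-part U h λ r → some-end λ q wy →
          other-end (subst (3 ≤_) (↭-length q) l) (part-singles q (part-pairs r h)) wy

  -- Partitions with exactly k classes

  -- Here and in the next three lemmas the forbidden non-adjacencies allow a regrouping into k - 1
  -- independent sets.
  singles-adjacent : ∀ {u v U ps} → Part k (u ∷ v ∷ U) ps → u ~ v
  singles-adjacent {u} {v} {U} {ps} (part p nn s) = force~ λ e →
    too-few ((u ∷ v ∷ []) ∷ []) U ps p (((e ∷ []) ∷ [] ∷ []) ∷ []) nn (≤-reflexive s)

  touches-pair : ∀ {u U x y ps} → Part k (u ∷ U) ((x , y) ∷ ps) → u ≁ x → u ≁ y → ⊥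
  touches-pair {u} {U} {x} {y} {ps} (part p (e ∷ nn) s) ux uy =
    too-few ((u ∷ x ∷ y ∷ []) ∷ []) U ps
      (↭-trans (solve 5 (λ u x y U F → (u ⊕ x ⊕ y ⊕ U ⊕ F) ⊜ (u ⊕ U ⊕ x ⊕ y ⊕ F)) ↭-refl
        [ u ] [ x ] [ y ] U (flat ps)) p)
      (((ux ∷ uy ∷ []) ∷ (e ∷ []) ∷ [] ∷ []) ∷ []) nn
      (≤-reflexive (trans (cong suc (sym (+-suc (length U) (length ps)))) s))

  no-cross : ∀ {u v U x y ps} → Part k (u ∷ v ∷ U) ((x , y) ∷ ps) → u ≁ x → v ≁ y → ⊥
  no-cross {u} {v} {U} {x} {y} {ps} (part p (_ ∷ nn) s) ux vy =
    too-few ((u ∷ x ∷ []) ∷ (v ∷ y ∷ []) ∷ []) U ps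
      (↭-trans (solve 6 (λ u v x y U F → (u ⊕ x ⊕ v ⊕ y ⊕ U ⊕ F) ⊜ (u ⊕ v ⊕ U ⊕ x ⊕ y ⊕ F)) ↭-refl
        [ u ] [ v ] [ x ] [ y ] U (flat ps)) p)
      (((ux ∷ []) ∷ [] ∷ []) ∷ ((vy ∷ []) ∷ [] ∷ []) ∷ []) nn
      (≤-reflexive (trans (cong (2 +_) (sym (+-suc (length U) (length ps)))) s))

  no-cross₂ : ∀ {u v U x y x′ y′ ps} → Part k (u ∷ v ∷ U) ((x , y) ∷ (x′ , y′) ∷ ps) →
              u ≁ x → v ≁ x′ → y ≁ y′ → ⊥
  no-cross₂ {u} {v} {U} {x} {y} {x′} {y′} {ps} (part p (_ ∷ _ ∷ nn) s) ux vx′ yy′ =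
    too-few [] U ((u , x) ∷ (v , x′) ∷ (y , y′) ∷ ps)
      (↭-trans (solve 8 (λ u v x y x′ y′ U F → (U ⊕ u ⊕ x ⊕ v ⊕ x′ ⊕ y ⊕ y′ ⊕ F) ⊜
                                               (u ⊕ v ⊕ U ⊕ x ⊕ y ⊕ x′ ⊕ y′ ⊕ F)) ↭-refl
        [ u ] [ v ] [ x ] [ y ] [ x′ ] [ y′ ] U (flat ps)) p)
      [] (ux ∷ vx′ ∷ yy′ ∷ nn)
      (≤-reflexive (trans (eq (length U) (length ps)) s))
    where
    eq : ∀ a b → suc (a + suc (suc (suc b))) ≡ suc (suc a) + suc (suc b)
    eq = solve-∀

  -- A singleton meets all k - 1 other classes (otherwise two classes merge) and has degree k.
  excess : ∀ {u U ps} → Part k (u ∷ U) ps → ∑ (degPair u) ps ≡ suc (length ps)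
  excess {u} {U} {ps} h = +-cancelˡ-≡ (length U) _ _ (begin
    length U + ∑ (degPair u) ps             ≡⟨ cong (_+ ∑ (degPair u) ps) (sym (cong₂ _+_ (⟦⟧-irr u)
                                                 (∑-≡-length (all-↭ U λ r → singles-adjacent (part-singles (prep u r) h))))) ⟩
    ∑ ⟦ u ,_⟧ (u ∷ U) + ∑ (degPair u) ps    ≡⟨ part-degree h u ⟩
    k                                       ≡⟨ Part.size h ⟨
    suc (length U) + length ps              ≡⟨ +-suc (length U) (length ps) ⟨
    length U + suc (length ps)              ∎) where open ≡-Reasoning

  touches≥1 : ∀ {u U p ps} → Part k (u ∷ U) (p ∷ ps) → 1 ≤ degPair u p
  touches≥1 h = one≥1 (touches-pair h)

  -- Call a pair full at `u` if `u` is adjacent to both its ends. Every pair receives an edge from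
  -- `u`, and `excess` provides just one more than the number of pairs.
  one-full-pair : ∀ {u U a b x y ps} → Part k (u ∷ U) ((a , b) ∷ (x , y) ∷ ps) →
                  u ~ a → u ~ b → u ~ x → u ~ y → ⊥
  one-full-pair {u} {ps = ps} h ua ub ux uy = 1+n≰n (≤-trans
    (+-mono-≤ (both ua ub) (+-mono-≤ (both ux uy) (≤-trans (≤-reflexive (sym (*-identityʳ (length ps))))
      (∑-≥ 1 (all-↭ ps λ r → touches≥1 (part-pairs
        (↭-trans (prep _ (prep _ r)) (solve 4 (λ a b c d → (a ⊕ b ⊕ c ⊕ d) ⊜ (c ⊕ a ⊕ b ⊕ d)) ↭-refl
          [ _ ] [ _ ] [ _ ] _)) h))))))
    (≤-reflexive (excess h)))

  -- Without a full pair the edges from `u` would not outnumber the pairs, against `excess`.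
  full-pair-exists : ∀ {u U ps} → Part k (u ∷ U) ps →
                     (∀ {a b qs} → ps ↭ (a , b) ∷ qs → u ~ a → u ~ b → ⊥) → ⊥
  full-pair-exists {u} {U} {ps} h none = 1+n≰n (≤-trans (≤-reflexive (sym (excess h)))
    (subst (∑ (degPair u) ps ≤_) (*-identityʳ (length ps)) (∑-≤ 1 (all-↭ ps λ r → one≤1 (none r)))))

  other-end : ∀ {w U x y ps} → Part k (w ∷ U) ((x , y) ∷ ps) → w ≁ y → All (_~ x) (w ∷ U)
  other-end {U = U} h wy = force~ (λ wx → touches-pair h wx wy) ∷
    all-↭ U λ r → force~ λ zx → no-cross (part-singles (prep _ r) (part-flip h)) wy zx

  orient-towards-singles : ∀ {u U ps} → Part k (u ∷ U) ps →
    ∃ λ qs → flat ps ↭ flat qs × length ps ≡ length qs × Part k (u ∷ U) qs ×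
             All (λ p → All (_~ proj₂ p) (u ∷ U)) qs
  orient-towards-singles {u} {U} h = orient-part (u ∷ U) h λ r → some-end λ q wy →
    other-end (part-singles q (part-pairs r h)) wy

  two-singles-impossible : ∀ {u v U ps} → Part k (u ∷ v ∷ U) ps → ⊥
  two-singles-impossible {u} {v} {U} {ps₀} h₀ = oriented (orient-towards-singles h₀) where
    -- The p + 2 vertices of `R` have degree sum (p + 2)k, but send only 2(k - 1) edges to the
    -- clique `Q`; inside `R` there are at most 4p ordered adjacencies between {a, b} and `X` and
    -- p(p - 1) within `X`. The total falls short by lp + 2.
    count : ∀ a b ps → Part k (u ∷ v ∷ U) ((a , b) ∷ ps) → AllPairs _~_ (u ∷ v ∷ U ++ mates ps) → ⊥
    count a b ps h c = lin-⊥ (suc (l * p)) upper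
      (trans (cong (λ t → suc (suc p) * t + p) k≡) (eq₁ l p)) where
      l = length U
      p = length ps
      Q = u ∷ v ∷ U ++ mates ps
      X = hubs ps
      R = a ∷ b ∷ X
      |Q| : length Q ≡ suc (suc (l + p))
      |Q| = cong (2 +_) (trans (length-++ U) (cong (l +_) (length-map proj₂ ps)))
      k≡ : k ≡ suc (suc (suc (l + p)))
      k≡ = trans (sym (Part.size h)) (cong (2 +_) (+-suc l p))
      perm : Q ++ R ↭ V₀
      perm = ↭-trans (↭-trans
        (solve 7 (λ u v a b U M X → ((u ⊕ v ⊕ U ⊕ M) ⊕ a ⊕ b ⊕ X) ⊜ (u ⊕ v ⊕ U ⊕ a ⊕ b ⊕ X ⊕ M)) ↭-refl
          [ u ] [ v ] [ a ] [ b ] U (mates ps) X)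
        (prep u (prep v (++⁺ˡ U (prep a (prep b (↭-sym (flat-split ps))))))))
        (Part.perm h)
      |X| : length X ≡ p
      |X| = length-map proj₁ ps
      inside : E R R + p ≤ 2 * p + 2 * p + p * p
      inside = begin
        E R R + p                                              ≡⟨ cong (_+ p) (E-++ˡ (a ∷ b ∷ []) X R) ⟩
        E (a ∷ b ∷ []) R + E X R + p                           ≡⟨ cong₂ (λ s t → s + t + p) (E-++ʳ (a ∷ b ∷ []) (a ∷ b ∷ []) X) (E-++ʳ X (a ∷ b ∷ []) X) ⟩
        E (a ∷ b ∷ []) (a ∷ b ∷ []) + E (a ∷ b ∷ []) X + (E X (a ∷ b ∷ []) + E X X) + p
                                                               ≡⟨ cong₂ (λ s t → s + E (a ∷ b ∷ []) X + (t + E X X) + p) ab≡0 (E-sym X (a ∷ b ∷ [])) ⟩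
        E (a ∷ b ∷ []) X + (E (a ∷ b ∷ []) X + E X X) + p      ≡⟨ eq (E (a ∷ b ∷ []) X) (E X X) p ⟩
        E (a ∷ b ∷ []) X + E (a ∷ b ∷ []) X + (E X X + p)      ≤⟨ +-mono-≤ (+-mono-≤ (abX) (abX)) XX ⟩
        2 * p + 2 * p + p * p                                  ∎ where
        open ≤-Reasoning
        eq : ∀ s t p → s + (s + t) + p ≡ s + s + (t + p)
        eq = solve-∀
        abX : E (a ∷ b ∷ []) X ≤ 2 * p
        abX = subst (λ t → E (a ∷ b ∷ []) X ≤ 2 * t) |X| (E-≤ (a ∷ b ∷ []) X)
        XX : E X X + p ≤ p * p
        XX = subst (λ t → E X X + t ≤ t * t) |X| (E-self X)
        ab≡0 : E (a ∷ b ∷ []) (a ∷ b ∷ []) ≡ 0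
        ab≡0 rewrite ⟦⟧-irr a | ⟦⟧-irr b | ≁⇒0 (All.head (Part.non h)) | ≁⇒0 (≁-sym (All.head (Part.non h))) = refl
      upper : suc (suc p) * k + p ≤ (suc (suc (l + p)) + suc (suc (l + p))) + (2 * p + 2 * p + p * p)
      upper = begin
        suc (suc p) * k + p        ≡⟨ cong (λ t → suc (suc t) * k + p) (sym |X|) ⟩
        length R * k + p           ≡⟨ cong (_+ p) (trans (sym (E-degree R perm)) (E-++ʳ R Q R)) ⟩
        E R Q + E R R + p          ≡⟨ +-assoc (E R Q) _ p ⟩
        E R Q + (E R R + p)        ≤⟨ +-monoʳ-≤ (E R Q) inside ⟩
        E R Q + (2 * p + 2 * p + p * p)
          ≡⟨ cong (_+ (2 * p + 2 * p + p * p)) (trans (E-clique-rest perm c (trans k≡ (cong suc (sym |Q|)))) (cong (λ t → t + t) |Q|)) ⟩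
        (suc (suc (l + p)) + suc (suc (l + p))) + (2 * p + 2 * p + p * p) ∎ where open ≤-Reasoning
      eq₁ : ∀ l p → suc (suc p) * suc (suc (suc (l + p))) + p ≡
            suc (suc (l * p) + ((suc (suc (l + p)) + suc (suc (l + p))) + (2 * p + 2 * p + p * p)))
      eq₁ = solve-∀

    -- As `u` is full at (a, b), it misses x and x′. If y ≁ y′, then `v` must be adjacent to both x
    -- and x′, for otherwise `no-cross₂` applies; but then `v` is full at two pairs.
    meet : ∀ {a b x y x′ y′ qs} → Part k (u ∷ v ∷ U) ((a , b) ∷ (x , y) ∷ (x′ , y′) ∷ qs) → u ~ a → u ~ b →
           All (_~ y) (u ∷ v ∷ U) → All (_~ y′) (u ∷ v ∷ U) → y ~ y′
    meet {x = x} {y} {x′} {y′} h ua ub (uy ∷ vy ∷ _) (uy′ ∷ vy′ ∷ _) = force~ λ yy′ →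
      full-at-v (force~ λ vx → no-cross₂ (part-singles (swap _ _ ↭-refl) h₁) vx ux′ yy′)
                (force~ λ vx′ → no-cross₂ h₁ ux vx′ yy′)
      where
      h₁ = part-pairs (solve 4 (λ a b c d → (a ⊕ b ⊕ c ⊕ d) ⊜ (b ⊕ c ⊕ a ⊕ d)) ↭-refl [ _ ] [ _ ] [ _ ] _) h
      ux : u ≁ x
      ux = force≁ λ e → one-full-pair h ua ub e uy
      ux′ : u ≁ x′
      ux′ = force≁ λ e → one-full-pair (part-pairs (prep _ (swap _ _ ↭-refl)) h) ua ub e uy′
      full-at-v : v ~ x → v ~ x′ → ⊥
      full-at-v vx vx′ = one-full-pair (part-singles (swap _ _ ↭-refl) h₁) vx vy vx′ vy′

    oriented : (∃ λ qs → flat ps₀ ↭ flat qs × length ps₀ ≡ length qs × Part k (u ∷ v ∷ U) qs ×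
                         All (λ p → All (_~ proj₂ p) (u ∷ v ∷ U)) qs) → ⊥
    oriented (qs , _ , _ , h , good) = full-pair-exists h λ {a} {b} {ps} r ua ub →
      let h′ = part-pairs r h in
      count a b ps h′ (mates-clique (allPairs-↭ (u ∷ v ∷ U) λ q → singles-adjacent (part-singles q h))
        (All.tail (All-resp-↭ r good)) λ q → meet (part-pairs (prep _ q) h′) ua ub)

  part-tail : ∀ {u p q ps qs} → flat ps ↭ flat qs → length ps ≡ length qs → All Nonadj qs →
            Part k [ u ] (p ∷ q ∷ ps) → Part k [ u ] (p ∷ q ∷ qs)
  part-tail {p = p} {q} r l nn h = part-flat (prep _ (prep _ (prep _ (prep _ r)))) (cong (2 +_) l)
    (All.head (Part.non h) ∷ All.head (All.tail (Part.non h)) ∷ nn) h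

  -- The unmatched place moves along the path u x y of the complement, so that what holds for
  -- singletons becomes available for `y`.
  reroot : ∀ {u x y ps} → Part k [ u ] ((x , y) ∷ ps) → u ≁ x → Part k [ y ] ((x , u) ∷ ps)
  reroot {u} {x} {y} {ps} (part p (_ ∷ nn) s) ux = part
    (↭-trans (solve 4 (λ u x y F → (y ⊕ x ⊕ u ⊕ F) ⊜ (u ⊕ x ⊕ y ⊕ F)) ↭-refl [ u ] [ x ] [ y ] (flat ps)) p)
    (≁-sym ux ∷ nn) s

  second-first : ∀ {U p q ps} → Part k U (p ∷ q ∷ ps) → Part k U (q ∷ p ∷ ps)
  second-first = part-pairs (swap _ _ ↭-refl)

  -- A triangle of the complement through the only singleton

  module Triangle {u x₁ y₁ x₂ y₂ : Fin n} (ux₁ : u ≁ x₁) (ux₂ : u ≁ x₂) (x₁x₂ : x₁ ≁ x₂) (9≤k : 9 ≤ k) where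

    Rooted : List (Pair (Fin n)) → Set
    Rooted ps = Part k [ u ] ((x₁ , y₁) ∷ (x₂ , y₂) ∷ ps)

    from-rooted : ∀ {ps qs} → ps ↭ qs → Rooted ps → Rooted qs
    from-rooted r = part-pairs (prep _ (prep _ r))

    triangle : AllPairs _≁_ (u ∷ x₁ ∷ x₂ ∷ [])
    triangle = (ux₁ ∷ ux₂ ∷ []) ∷ (x₁x₂ ∷ []) ∷ [] ∷ []

    root₁ : ∀ {ps} → Rooted ps → Part k [ y₁ ] ((x₁ , u) ∷ (x₂ , y₂) ∷ ps)
    root₁ h = reroot h ux₁

    root₂ : ∀ {ps} → Rooted ps → Part k [ y₂ ] ((x₂ , u) ∷ (x₁ , y₁) ∷ ps)
    root₂ h = reroot (second-first h) ux₂

    to-front : ∀ {U p q s ps rs} → ps ↭ s ∷ rs → Part k U (p ∷ q ∷ ps) → Part k U (s ∷ p ∷ q ∷ rs)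
    to-front {p = p} {q} {s} {rs = rs} r = part-pairs (↭-trans (prep _ (prep _ r))
      (solve 4 (λ p q s t → (p ⊕ q ⊕ s ⊕ t) ⊜ (s ⊕ p ⊕ q ⊕ t)) ↭-refl [ p ] [ q ] [ s ] rs))

    two-to-front : ∀ {U p q s t ps rs} → ps ↭ s ∷ t ∷ rs → Part k U (p ∷ q ∷ ps) → Part k U (s ∷ t ∷ p ∷ q ∷ rs)
    two-to-front {p = p} {q} {s} {t} {rs = rs} r = part-pairs (↭-trans (prep _ (prep _ r))
      (solve 5 (λ p q s t r → (p ⊕ q ⊕ s ⊕ t ⊕ r) ⊜ (s ⊕ t ⊕ p ⊕ q ⊕ r)) ↭-refl [ p ] [ q ] [ s ] [ t ] rs))

    -- With {u, x₁, x₂} as one class, y₁ and y₂ become singletons and there are still k classes.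
    -- Joining y₁ to y₂, directly here or by a longer alternating path in `cross`, `cross₂` and
    -- `cross₄`, saves a class.
    ends-adjacent : ∀ {ps} → Rooted ps → y₁ ~ y₂
    ends-adjacent {ps} (part p (_ ∷ _ ∷ nn) s) = force~ λ e →
      too-few ((u ∷ x₁ ∷ x₂ ∷ []) ∷ []) [] ((y₁ , y₂) ∷ ps)
        (↭-trans (solve 6 (λ u a b c d F → (u ⊕ a ⊕ c ⊕ b ⊕ d ⊕ F) ⊜ (u ⊕ a ⊕ b ⊕ c ⊕ d ⊕ F)) ↭-refl
          [ u ] [ x₁ ] [ y₁ ] [ x₂ ] [ y₂ ] (flat ps)) p)
        (triangle ∷ []) (e ∷ nn) (≤-reflexive s)

    cross : ∀ {z w ps} → Rooted ((z , w) ∷ ps) → y₁ ≁ z → y₂ ≁ w → ⊥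
    cross {z} {w} {ps} (part p (_ ∷ _ ∷ _ ∷ nn) s) e e′ =
      too-few ((u ∷ x₁ ∷ x₂ ∷ []) ∷ []) [] ((y₁ , z) ∷ (y₂ , w) ∷ ps)
        (↭-trans (solve 8 (λ u a b c d z w F → (u ⊕ a ⊕ c ⊕ b ⊕ z ⊕ d ⊕ w ⊕ F) ⊜ (u ⊕ a ⊕ b ⊕ c ⊕ d ⊕ z ⊕ w ⊕ F)) ↭-refl
          [ u ] [ x₁ ] [ y₁ ] [ x₂ ] [ y₂ ] [ z ] [ w ] (flat ps)) p)
        (triangle ∷ []) (e ∷ e′ ∷ nn) (≤-reflexive s)

    cross₂ : ∀ {z w z′ w′ ps} → Rooted ((z , w) ∷ (z′ , w′) ∷ ps) → y₁ ≁ z → y₂ ≁ z′ → w ≁ w′ → ⊥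
    cross₂ {z} {w} {z′} {w′} {ps} (part p (_ ∷ _ ∷ _ ∷ _ ∷ nn) s) e e′ e″ =
      too-few ((u ∷ x₁ ∷ x₂ ∷ []) ∷ []) [] ((y₁ , z) ∷ (y₂ , z′) ∷ (w , w′) ∷ ps)
        (↭-trans (solve 10 (λ u a b c d z w z′ w′ F → (u ⊕ a ⊕ c ⊕ b ⊕ z ⊕ d ⊕ z′ ⊕ w ⊕ w′ ⊕ F) ⊜
                                                      (u ⊕ a ⊕ b ⊕ c ⊕ d ⊕ z ⊕ w ⊕ z′ ⊕ w′ ⊕ F)) ↭-refl
          [ u ] [ x₁ ] [ y₁ ] [ x₂ ] [ y₂ ] [ z ] [ w ] [ z′ ] [ w′ ] (flat ps)) p)
        (triangle ∷ []) (e ∷ e′ ∷ e″ ∷ nn) (≤-reflexive s)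

    -- The new classes are {u, x₁, x₂}, {w, e, f}, {y₁, z} and {y₂}, four in place of five.
    cross₃ : ∀ {e f z w ps} → Rooted ((e , f) ∷ (z , w) ∷ ps) → y₁ ≁ z → w ≁ e → w ≁ f → ⊥
    cross₃ {z} {w} {z′} {w′} {ps} (part p (_ ∷ _ ∷ ef ∷ _ ∷ nn) s) yz we wf =
      too-few ((u ∷ x₁ ∷ x₂ ∷ []) ∷ (w′ ∷ z ∷ w ∷ []) ∷ []) [ y₂ ] ((y₁ , z′) ∷ ps)
        (↭-trans (solve 10 (λ u a b c d z w z′ w′ F → (u ⊕ a ⊕ c ⊕ w′ ⊕ z ⊕ w ⊕ d ⊕ b ⊕ z′ ⊕ F) ⊜
                                                      (u ⊕ a ⊕ b ⊕ c ⊕ d ⊕ z ⊕ w ⊕ z′ ⊕ w′ ⊕ F)) ↭-refl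
          [ u ] [ x₁ ] [ y₁ ] [ x₂ ] [ y₂ ] [ z ] [ w ] [ z′ ] [ w′ ] (flat ps)) p)
        (triangle ∷ ((we ∷ wf ∷ []) ∷ (ef ∷ []) ∷ [] ∷ []) ∷ []) (yz ∷ nn) (≤-reflexive s)

    -- The augmenting path is y₁ z w f e w′ z′ y₂.
    cross₄ : ∀ {e f z w z′ w′ ps} → Rooted ((e , f) ∷ (z , w) ∷ (z′ , w′) ∷ ps) →
             y₁ ≁ z → w ≁ f → e ≁ w′ → z′ ≁ y₂ → ⊥
    cross₄ {e} {f} {z} {w} {z′} {w′} {ps} (part p (_ ∷ _ ∷ _ ∷ _ ∷ _ ∷ nn) s) yz wf ew zy =
      too-few ((u ∷ x₁ ∷ x₂ ∷ []) ∷ []) [] ((y₁ , z) ∷ (w , f) ∷ (e , w′) ∷ (z′ , y₂) ∷ ps)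
        (↭-trans (solve 12 (λ u a b c d e f z w z′ w′ F → (u ⊕ a ⊕ c ⊕ b ⊕ z ⊕ w ⊕ f ⊕ e ⊕ w′ ⊕ z′ ⊕ d ⊕ F) ⊜
                                                      (u ⊕ a ⊕ b ⊕ c ⊕ d ⊕ e ⊕ f ⊕ z ⊕ w ⊕ z′ ⊕ w′ ⊕ F)) ↭-refl
          [ u ] [ x₁ ] [ y₁ ] [ x₂ ] [ y₂ ] [ e ] [ f ] [ z ] [ w ] [ z′ ] [ w′ ] (flat ps)) p)
        (triangle ∷ []) (yz ∷ wf ∷ ew ∷ zy ∷ nn) (≤-reflexive s)

    -- The independent triple is now {u, x₁, w}; the pair (x₂, y₂) is kept and y₁ joins z.
    cross₅ : ∀ {z w ps} → Rooted ((z , w) ∷ ps) → u ≁ w → x₁ ≁ w → y₁ ≁ z → ⊥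
    cross₅ {z} {w} {ps} (part p (_ ∷ e ∷ _ ∷ nn) s) uw xw yz =
      too-few ((u ∷ x₁ ∷ w ∷ []) ∷ []) [] ((x₂ , y₂) ∷ (y₁ , z) ∷ ps)
        (↭-trans (solve 8 (λ u a b c d z w F → (u ⊕ a ⊕ w ⊕ c ⊕ d ⊕ b ⊕ z ⊕ F) ⊜ (u ⊕ a ⊕ b ⊕ c ⊕ d ⊕ z ⊕ w ⊕ F)) ↭-refl
          [ u ] [ x₁ ] [ y₁ ] [ x₂ ] [ y₂ ] [ z ] [ w ] (flat ps)) p)
        (((ux₁ ∷ uw ∷ []) ∷ (xw ∷ []) ∷ [] ∷ []) ∷ []) (e ∷ yz ∷ nn) (≤-reflexive s)

    -- Counting the edges at the complement B of the (k - 1)-clique Q bounds the number τ of edges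
    -- from the triangle to Q above by (k + 10) / 2, while cross₅ bounds it below by k + 1.
    clique-impossible : ∀ {ps} → Rooted ps → AllPairs _~_ (y₁ ∷ y₂ ∷ mates ps) → ⊥
    clique-impossible {ps} h c = 1+n≰n (≤-trans 6≤q (+-cancelˡ-≤ (q + 8) q 5 (begin
      q + 8 + q                             ≡⟨ eq₀ q ⟩
      (q + 4) + (q + 4)                     ≤⟨ +-mono-≤ τ≥ τ≥ ⟩
      τ + τ                                 ≤⟨ 2τ≤ ⟩
      q + 13                                ≡⟨ +-assoc q 8 5 ⟨
      q + 8 + 5                             ∎))) where
      open ≤-Reasoning
      q = length ps
      W = mates ps
      Z = hubs ps
      T = u ∷ x₁ ∷ x₂ ∷ []
      Q = y₁ ∷ y₂ ∷ W
      eq₀ : ∀ q → q + 8 + q ≡ (q + 4) + (q + 4)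
      eq₀ = solve-∀
      k≡ : k ≡ 3 + q
      k≡ = sym (Part.size h)
      6≤q : 6 ≤ q
      6≤q = +-cancelˡ-≤ 3 6 q (subst (9 ≤_) k≡ 9≤k)
      |Z| : length Z ≡ q
      |Z| = length-map proj₁ ps
      |Q| : length Q ≡ 2 + q
      |Q| = cong (2 +_) (length-map proj₂ ps)
      perm : Q ++ T ++ Z ↭ V₀
      perm = ↭-trans (↭-trans
        (solve 7 (λ u a b c d Z W → ((b ⊕ d ⊕ W) ⊕ (u ⊕ a ⊕ c) ⊕ Z) ⊜ (u ⊕ a ⊕ b ⊕ c ⊕ d ⊕ Z ⊕ W)) ↭-refl
          [ u ] [ x₁ ] [ y₁ ] [ x₂ ] [ y₂ ] Z W)
        (prep u (prep x₁ (prep y₁ (prep x₂ (prep y₂ (↭-sym (flat-split ps))))))))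
        (Part.perm h)
      τ = E T Q

      u~y₁ : u ~ y₁
      u~y₁ = force~ λ e → touches-pair h ux₁ e
      u~y₂ : u ~ y₂
      u~y₂ = force~ λ e → touches-pair (second-first h) ux₂ e

      -- Of its q + 3 neighbours, y₁ has q + 1 in `Q`, and `u` is another.
      y₁-rest : ∑ ⟦ y₁ ,_⟧ Z ≤ 1
      y₁-rest = +-cancelˡ-≤ (2 + q) _ 1 (begin
        2 + q + ∑ ⟦ y₁ ,_⟧ Z                    ≡⟨ cong (λ t → suc (suc (t + ∑ ⟦ y₁ ,_⟧ Z))) (sym (length-map proj₂ ps)) ⟩
        2 + length W + ∑ ⟦ y₁ ,_⟧ Z             ≡⟨ +-suc (suc (length W)) (∑ ⟦ y₁ ,_⟧ Z) ⟨
        1 + length W + (1 + ∑ ⟦ y₁ ,_⟧ Z)       ≡⟨ cong₂ _+_ (sym (cong₂ _+_ (⟦⟧-irr y₁) (∑-≡-length (AllPairs.head c)))) (cong (_+ ∑ ⟦ y₁ ,_⟧ Z) (sym (~⇒1 (~-sym u~y₁)))) ⟩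
        ∑ ⟦ y₁ ,_⟧ Q + (⟦ y₁ , u ⟧ + ∑ ⟦ y₁ ,_⟧ Z)  ≤⟨ +-monoʳ-≤ (∑ ⟦ y₁ ,_⟧ Q) (+-monoʳ-≤ ⟦ y₁ , u ⟧
                                                   (≤-trans (m≤n+m _ ⟦ y₁ , x₂ ⟧) (m≤n+m _ ⟦ y₁ , x₁ ⟧))) ⟩
        ∑ ⟦ y₁ ,_⟧ Q + ∑ ⟦ y₁ ,_⟧ (T ++ Z)      ≡⟨ ∑-++ ⟦ y₁ ,_⟧ Q (T ++ Z) ⟨
        ∑ ⟦ y₁ ,_⟧ (Q ++ T ++ Z)                ≡⟨ trans (degree-↭ perm y₁) k≡ ⟩
        3 + q                                   ≡⟨ +-comm 1 (2 + q) ⟩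
        2 + q + 1                               ∎)

      -- By `cross₅` each pair (z, w) has u ~ w, x₁ ~ w or y₁ ~ z, and the last happens at most
      -- once.
      u-x₁ : q ≤ ∑ ⟦ u ,_⟧ W + ∑ ⟦ x₁ ,_⟧ W + 1
      u-x₁ = begin
        q                                                        ≡⟨ *-identityʳ q ⟨
        q * 1                                                    ≤⟨ ∑-≥ 1 (all-↭ ps λ r → three (from-rooted r h)) ⟩
        ∑ (λ p → ⟦ u , proj₂ p ⟧ + ⟦ x₁ , proj₂ p ⟧ + ⟦ y₁ , proj₁ p ⟧) ps
          ≡⟨ trans (∑-+ _ _ ps) (cong (_+ ∑ (λ p → ⟦ y₁ , proj₁ p ⟧) ps) (∑-+ _ _ ps)) ⟩
        ∑ (λ p → ⟦ u , proj₂ p ⟧) ps + ∑ (λ p → ⟦ x₁ , proj₂ p ⟧) ps + ∑ (λ p → ⟦ y₁ , proj₁ p ⟧) ps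
          ≡⟨ cong₂ _+_ (cong₂ _+_ (∑-map ⟦ u ,_⟧ proj₂ ps) (∑-map ⟦ x₁ ,_⟧ proj₂ ps)) (∑-map ⟦ y₁ ,_⟧ proj₁ ps) ⟨
        ∑ ⟦ u ,_⟧ W + ∑ ⟦ x₁ ,_⟧ W + ∑ ⟦ y₁ ,_⟧ Z                ≤⟨ +-monoʳ-≤ (∑ ⟦ u ,_⟧ W + ∑ ⟦ x₁ ,_⟧ W) y₁-rest ⟩
        ∑ ⟦ u ,_⟧ W + ∑ ⟦ x₁ ,_⟧ W + 1                           ∎
        where
        three : ∀ {z w qs} → Rooted ((z , w) ∷ qs) → 1 ≤ ⟦ u , w ⟧ + ⟦ x₁ , w ⟧ + ⟦ y₁ , z ⟧
        three {z} {w} h with g u w in uw | g x₁ w in xw | g y₁ z in yz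
        ... | true  | _     | _     = s≤s z≤n
        ... | false | true  | _     = s≤s z≤n
        ... | false | false | true  = s≤s z≤n
        ... | false | false | false = ⊥-elim (cross₅ h uw xw yz)

      -- The q + 3 neighbours of x₂ avoid `T`, and at most q of them lie in `Z`.
      x₂-Q : 3 ≤ ∑ ⟦ x₂ ,_⟧ Q
      x₂-Q = +-cancelʳ-≤ q 3 _ (begin
        3 + q                                       ≡⟨ trans (degree-↭ perm x₂) k≡ ⟨
        ∑ ⟦ x₂ ,_⟧ (Q ++ T ++ Z)                    ≡⟨ ∑-++ ⟦ x₂ ,_⟧ Q (T ++ Z) ⟩
        ∑ ⟦ x₂ ,_⟧ Q + ∑ ⟦ x₂ ,_⟧ (T ++ Z)          ≡⟨ cong (∑ ⟦ x₂ ,_⟧ Q +_) (cong₂ _+_ (≁⇒0 (≁-sym ux₂))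
                                                       (cong₂ _+_ (≁⇒0 (≁-sym x₁x₂)) (cong (_+ ∑ ⟦ x₂ ,_⟧ Z) (⟦⟧-irr x₂)))) ⟩
        ∑ ⟦ x₂ ,_⟧ Q + ∑ ⟦ x₂ ,_⟧ Z                 ≤⟨ +-monoʳ-≤ (∑ ⟦ x₂ ,_⟧ Q) (subst (∑ ⟦ x₂ ,_⟧ Z ≤_) |Z| (∑-≤-length x₂ Z)) ⟩
        ∑ ⟦ x₂ ,_⟧ Q + q                            ∎)

      τ≥ : q + 4 ≤ τ
      τ≥ = begin
        q + 4                                                ≤⟨ +-monoˡ-≤ 4 u-x₁ ⟩
        ∑ ⟦ u ,_⟧ W + ∑ ⟦ x₁ ,_⟧ W + 1 + 4                   ≡⟨ eq (∑ ⟦ u ,_⟧ W) (∑ ⟦ x₁ ,_⟧ W) ⟩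
        (2 + ∑ ⟦ u ,_⟧ W) + (∑ ⟦ x₁ ,_⟧ W + (3 + 0))         ≤⟨ +-mono-≤ (≤-reflexive (cong₂ (λ s t → s + (t + ∑ ⟦ u ,_⟧ W)) (sym (~⇒1 u~y₁)) (sym (~⇒1 u~y₂))))
                                                                 (+-mono-≤ (≤-trans (m≤n+m _ ⟦ x₁ , y₂ ⟧) (m≤n+m _ ⟦ x₁ , y₁ ⟧)) (+-monoˡ-≤ 0 x₂-Q)) ⟩
        τ                                                    ∎ where
        eq : ∀ a b → a + b + 1 + 4 ≡ (2 + a) + (b + (3 + 0))
        eq = solve-∀

      TT : E T T ≡ 0
      TT rewrite ⟦⟧-irr u | ⟦⟧-irr x₁ | ⟦⟧-irr x₂ | ≁⇒0 ux₁ | ≁⇒0 ux₂ | ≁⇒0 x₁x₂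
               | ≁⇒0 (≁-sym ux₁) | ≁⇒0 (≁-sym ux₂) | ≁⇒0 (≁-sym x₁x₂) = refl

      from-T : τ + E T Z ≡ 3 * (3 + q)
      from-T = begin-equality
        τ + E T Z                ≡⟨ cong (λ t → τ + (t + E T Z)) TT ⟨
        τ + (E T T + E T Z)      ≡⟨ cong (τ +_) (E-++ʳ T T Z) ⟨
        τ + E T (T ++ Z)         ≡⟨ E-++ʳ T Q (T ++ Z) ⟨
        E T (Q ++ T ++ Z)        ≡⟨ trans (E-degree T perm) (cong (3 *_) k≡) ⟩
        3 * (3 + q)              ∎

      from-Q : τ + E Z Q ≡ 2 * (2 + q)
      from-Q = begin-equality
        τ + E Z Q                ≡⟨ E-++ˡ T Z Q ⟨
        E (T ++ Z) Q             ≡⟨ E-clique-rest perm c (trans k≡ (cong suc (sym |Q|))) ⟩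
        length Q + length Q      ≡⟨ cong (λ t → t + t) |Q| ⟩
        2 + q + (2 + q)          ≡⟨ cong ((2 + q) +_) (+-identityʳ (2 + q)) ⟨
        2 * (2 + q)              ∎

      from-Z : E Z Q + (E T Z + E Z Z) ≡ q * (3 + q)
      from-Z = begin-equality
        E Z Q + (E T Z + E Z Z)  ≡⟨ cong (λ t → E Z Q + (t + E Z Z)) (E-sym T Z) ⟩
        E Z Q + (E Z T + E Z Z)  ≡⟨ cong (E Z Q +_) (E-++ʳ Z T Z) ⟨
        E Z Q + E Z (T ++ Z)     ≡⟨ E-++ʳ Z Q (T ++ Z) ⟨
        E Z (Q ++ T ++ Z)        ≡⟨ trans (E-degree Z perm) (cong₂ _*_ |Z| k≡) ⟩
        q * (3 + q)              ∎

      -- The degree sum of `Z` is combined with those counts that fix τ + E T Z and τ + E Z Q; what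
      -- remains is E Z Z, at most q² - q.
      2τ≤ : τ + τ ≤ q + 13
      2τ≤ = +-cancelʳ-≤ (q * (3 + q) + q) _ _ (begin
        τ + τ + (q * (3 + q) + q)                          ≡⟨ cong (λ t → τ + τ + (t + q)) from-Z ⟨
        τ + τ + (E Z Q + (E T Z + E Z Z) + q)              ≡⟨ eq₁ τ (E Z Q) (E T Z) (E Z Z) q ⟩
        (τ + E T Z) + (τ + E Z Q) + (E Z Z + q)            ≤⟨ +-mono-≤ (≤-reflexive (cong₂ _+_ from-T from-Q))
                                                                (subst (λ t → E Z Z + t ≤ t * t) |Z| (E-self Z)) ⟩
        3 * (3 + q) + 2 * (2 + q) + q * q                  ≡⟨ eq₂ q ⟩
        q + 13 + (q * (3 + q) + q)                         ∎) where
        eq₁ : ∀ t a b c q → t + t + (a + (b + c) + q) ≡ (t + b) + (t + a) + (c + q)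
        eq₁ = solve-∀
        eq₂ : ∀ q → 3 * (3 + q) + 2 * (2 + q) + q * q ≡ q + 13 + (q * (3 + q) + q)
        eq₂ = solve-∀

    flip₃ : ∀ {z w ps} → Rooted ((z , w) ∷ ps) → Rooted ((w , z) ∷ ps)
    flip₃ h = part-tail (swap _ _ ↭-refl) refl
      (≁-sym (All.head (All.tail (All.tail (Part.non h)))) ∷ All.tail (All.tail (All.tail (Part.non h)))) h

    not-both : ∀ {v : Fin n} {U e f z w ps} → Part k (v ∷ U) ((e , f) ∷ (z , w) ∷ ps) →
               v ~ e → v ~ f → v ~ w → v ≁ z
    not-both h ve vf vw = force≁ λ vz → one-full-pair h ve vf vz vw

    -- Both y₁ and y₂ are full at (e, f), so they miss the first ends of all pairs in `ps`, and
    -- `cross₂` makes them a clique with the second ends. Either f extends this clique, or f misses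
    -- some w; then e is adjacent to w by `cross₃`, to the other second ends by `cross₄`, and
    -- extends it instead.
    full-pair-impossible : ∀ {e f ps} → Rooted ((e , f) ∷ ps) → y₁ ~ e → y₁ ~ f → y₂ ~ e → y₂ ~ f →
                           All (λ p → All (_~ proj₂ p) (y₁ ∷ y₂ ∷ [])) ps → ⊥
    full-pair-impossible {e} {f} {ps} h ye yf y′e y′f good =
      clique-impossible h (extend yf y′f (all-↭ ps λ r → force~ (missed-f r)))
      where
      far₁ : ∀ {z w qs} → ps ↭ (z , w) ∷ qs → y₁ ≁ z
      far₁ r = not-both (two-to-front (prep _ r) (root₁ h)) ye yf (All.head (All.head (All-resp-↭ r good)))
      far₂ : ∀ {z w qs} → ps ↭ (z , w) ∷ qs → y₂ ≁ z
      far₂ r = not-both (two-to-front (prep _ r) (root₂ h)) y′e y′f (All.head (All.tail (All.head (All-resp-↭ r good))))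
      rest : AllPairs _~_ (y₁ ∷ y₂ ∷ mates ps)
      rest = mates-clique ((ends-adjacent h ∷ []) ∷ [] ∷ []) good λ r _ _ → force~ λ e →
        cross₂ (from-rooted (↭-trans (prep _ r) (solve 4 (λ a b c d → (a ⊕ b ⊕ c ⊕ d) ⊜ (b ⊕ c ⊕ a ⊕ d)) ↭-refl
          [ _ ] [ _ ] [ _ ] _)) h) (far₁ r) (far₂ (↭-trans r (swap _ _ ↭-refl))) e
      extend : ∀ {d} → y₁ ~ d → y₂ ~ d → All (λ p → d ~ proj₂ p) ps → AllPairs _~_ (y₁ ∷ y₂ ∷ d ∷ mates ps)
      extend {d} yd y′d a = insert rest where
        insert : AllPairs _~_ (y₁ ∷ y₂ ∷ mates ps) → AllPairs _~_ (y₁ ∷ y₂ ∷ d ∷ mates ps)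
        insert ((yy′ ∷ ym) ∷ y′m ∷ mm) = (yy′ ∷ yd ∷ ym) ∷ (y′d ∷ y′m) ∷ All.map⁺ a ∷ mm
      missed-f : ∀ {z w qs} → ps ↭ (z , w) ∷ qs → f ≁ w → ⊥
      missed-f {z} {w} {qs} r fw = clique-impossible
        (flip₃ h)
        (extend ye y′e (All-resp-↭ (↭-sym r) (near ∷ all-↭ qs λ q → force~ λ ew →
          cross₄ (from-rooted (prep _ (↭-trans r (prep _ q))) h) (far₁ r) (≁-sym fw) ew
            (≁-sym (far₂ (↭-trans r (↭-trans (prep _ q) (swap _ _ ↭-refl))))))))
        where
        near : e ~ w
        near = force~ λ ew → cross₃ (from-rooted (prep _ r) h) (far₁ r) (≁-sym ew) (≁-sym fw)

    oriented-impossible : ∀ {ps} → Rooted ps → All (λ p → All (_~ proj₂ p) (y₁ ∷ y₂ ∷ [])) ps → ⊥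
    oriented-impossible {ps} h good = clique-impossible h
      (mates-clique ((ends-adjacent h ∷ []) ∷ [] ∷ []) good meet)
      where
      Y = y₁ ∷ y₂ ∷ []
      full : ∀ {e f qs} → ps ↭ (e , f) ∷ qs → y₁ ~ e → y₂ ~ e → ⊥
      full r ye y′e = full-pair-impossible (from-rooted r h) ye (All.head yf) y′e (All.head (All.tail yf)) (All.tail good′)
        where
        good′ = All-resp-↭ r good
        yf = All.head good′
      -- If w ≁ w′, `cross₂` forces y₁ ~ z or y₂ ~ z′, and also y₁ ~ z′ or y₂ ~ z. As y₁ and y₂ are
      -- each full at no more than one pair, some pair would be full at both, which `full` excludes.
      meet : ∀ {z w z′ w′ qs} → ps ↭ (z , w) ∷ (z′ , w′) ∷ qs → All (_~ w) Y → All (_~ w′) Y → w ~ w′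
      meet {z} {w} {z′} {w′} {qs} r (yw ∷ y′w ∷ []) (yw′ ∷ y′w′ ∷ []) = force~ λ e →
        let h₁ = from-rooted r h
            r′ = ↭-trans r (swap _ _ ↭-refl)
            h₂ = from-rooted r′ h
            y≁z : y₁ ≁ z
            y≁z = force≁ λ yz →
              let y≁z′ = not-both (two-to-front r (root₁ h)) yz yw yw′
              in full r yz (force~ λ y′z → cross₂ h₂ y≁z′ y′z (≁-sym e))
            y′z′ : y₂ ~ z′
            y′z′ = force~ λ y′z′ → cross₂ h₁ y≁z y′z′ e
            y≁z′ : y₁ ≁ z′
            y≁z′ = force≁ λ yz′ → full r′ yz′ y′z′
        in cross₂ h₂ y≁z′ (not-both (two-to-front r′ (root₂ h)) y′z′ y′w′ y′w) (≁-sym e)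

    impossible : ∀ {ps} → Rooted ps → ⊥
    impossible {ps} h = finish (orient-part (y₁ ∷ y₂ ∷ []) loose half)
      where
      -- Only the pairs of `ps` may be reversed, so the five special vertices are listed as
      -- singletons; the resulting number of classes is unrelated to k.
      loose : Part (5 + length ps) (u ∷ x₁ ∷ y₁ ∷ x₂ ∷ y₂ ∷ []) ps
      loose = part (Part.perm h) (All.tail (All.tail (Part.non h))) refl
      half : ∀ {z w qs} → ps ↭ (z , w) ∷ qs → All (_~ w) (y₁ ∷ y₂ ∷ []) ⊎ All (_~ z) (y₁ ∷ y₂ ∷ [])
      half {z} {w} r = split (~? y₁ w) (~? y₂ w) where
        h′ = from-rooted r h
        split : y₁ ~ w ⊎ y₁ ≁ w → y₂ ~ w ⊎ y₂ ≁ w → All (_~ w) (y₁ ∷ y₂ ∷ []) ⊎ All (_~ z) (y₁ ∷ y₂ ∷ [])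
        split (inj₁ yw) (inj₁ y′w) = inj₁ (yw ∷ y′w ∷ [])
        split (inj₁ yw) (inj₂ y′w) = inj₂ ((force~ λ yz → cross h′ yz y′w) ∷
          (force~ λ y′z → touches-pair (to-front r (root₂ h)) y′z y′w) ∷ [])
        split (inj₂ yw) _          = inj₂ ((force~ λ yz → touches-pair (to-front r (root₁ h)) yz yw) ∷
          (force~ λ y′z → cross (flip₃ h′) yw y′z) ∷ [])
      finish : (∃ λ qs → flat ps ↭ flat qs × length ps ≡ length qs × Part _ (u ∷ x₁ ∷ y₁ ∷ x₂ ∷ y₂ ∷ []) qs ×
                         All (λ p → All (_~ proj₂ p) (y₁ ∷ y₂ ∷ [])) qs) → ⊥
      finish (qs , r , l , h′ , good) = oriented-impossible (part-tail r l (Part.non h′) h) good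

  -- u x₁ y₁ y₂ x₂ is a 5-cycle of the complement; by the triangle argument no further vertex
  -- is joined in the complement to two consecutive vertices of it.
  five-cycle-impossible : ∀ {u x₁ y₁ x₂ y₂ ps} → 9 ≤ k → Part k [ u ] ((x₁ , y₁) ∷ (x₂ , y₂) ∷ ps) →
                          u ≁ x₁ → u ≁ x₂ → y₁ ≁ y₂ → ⊥
  five-cycle-impossible {u} {x₁} {y₁} {x₂} {y₂} {ps} 9≤k h ux₁ ux₂ yy = 1+n≰n (≤-trans 6≤q
    (+-cancelʳ-≤ (10 + 5 * q) q 5 (begin
      -- Each cycle vertex has two neighbours on the cycle, and each of the 2q other vertices has at
      -- least three there; against the degree sum 5(q + 3) this forces q ≤ 5.
      q + (10 + 5 * q)           ≡⟨ eq₁ q ⟩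
      10 + (q + q) * 3           ≡⟨ cong (λ t → 10 + t * 3) (length-flat ps) ⟨
      10 + length W * 3          ≤⟨ +-mono-≤ cycle (∑-≥ 3 outside) ⟩
      E C C + E W C              ≡⟨ cong (E C C +_) (E-sym W C) ⟩
      E C C + E C W              ≡⟨ E-++ʳ C C W ⟨
      E C (C ++ W)               ≡⟨ trans (E-degree C perm) (cong (5 *_) (sym (Part.size h))) ⟩
      5 * (3 + q)                ≡⟨ eq₂ q ⟩
      5 + (10 + 5 * q)           ∎)))
    where
    open ≤-Reasoning
    q = length ps
    W = flat ps
    C = u ∷ x₁ ∷ y₁ ∷ y₂ ∷ x₂ ∷ []
    eq₁ : ∀ q → q + (10 + 5 * q) ≡ 10 + (q + q) * 3
    eq₁ = solve-∀
    eq₂ : ∀ q → 5 * (3 + q) ≡ 5 + (10 + 5 * q)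
    eq₂ = solve-∀
    6≤q : 6 ≤ q
    6≤q = +-cancelˡ-≤ 3 6 q (subst (9 ≤_) (sym (Part.size h)) 9≤k)
    perm : C ++ W ↭ V₀
    perm = ↭-trans (solve 6 (λ u a b c d F → (u ⊕ a ⊕ b ⊕ d ⊕ c ⊕ F) ⊜ (u ⊕ a ⊕ b ⊕ c ⊕ d ⊕ F)) ↭-refl
      [ u ] [ x₁ ] [ y₁ ] [ x₂ ] [ y₂ ] W) (Part.perm h)

    no-triangle : ∀ {v a b c d qs} → Part k [ v ] ((a , b) ∷ (c , d) ∷ qs) → v ≁ a → v ≁ c → a ≁ c → ⊥
    no-triangle h e e′ e″ = Triangle.impossible e e′ e″ 9≤k h

    h₂ : Part k [ u ] ((x₂ , y₂) ∷ (x₁ , y₁) ∷ ps)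
    h₂ = second-first h
    at-y₁ : Part k [ y₁ ] ((x₁ , u) ∷ (x₂ , y₂) ∷ ps)
    at-y₁ = reroot h ux₁
    at-y₂ : Part k [ y₂ ] ((x₂ , u) ∷ (x₁ , y₁) ∷ ps)
    at-y₂ = reroot h₂ ux₂
    y₁x₁ : y₁ ≁ x₁
    y₁x₁ = ≁-sym (All.head (Part.non h))
    y₂x₂ : y₂ ≁ x₂
    y₂x₂ = ≁-sym (All.head (Part.non h₂))

    flip₂ : ∀ {v p x y qs} → Part k [ v ] (p ∷ (x , y) ∷ qs) → Part k [ v ] (p ∷ (y , x) ∷ qs)
    flip₂ h = second-first (part-flip (second-first h))

    x₁~x₂ : x₁ ~ x₂
    x₁~x₂ = force~ (no-triangle h ux₁ ux₂)
    x₁~y₂ : x₁ ~ y₂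
    x₁~y₂ = force~ (no-triangle (flip₂ at-y₁) y₁x₁ yy)
    x₂~y₁ : x₂ ~ y₁
    x₂~y₁ = force~ (no-triangle (flip₂ at-y₂) y₂x₂ (≁-sym yy))
    u~y₁ : u ~ y₁
    u~y₁ = force~ λ e → touches-pair h ux₁ e
    u~y₂ : u ~ y₂
    u~y₂ = force~ λ e → touches-pair h₂ ux₂ e

    two : ∀ {v a b xs} → v ~ a → v ~ b → C ↭ a ∷ b ∷ xs → 2 ≤ ∑ ⟦ v ,_⟧ C
    two {v} {a} {b} {xs} va vb r = subst (2 ≤_) (trans (+-assoc ⟦ v , a ⟧ ⟦ v , b ⟧ _) (sym (∑-↭ ⟦ v ,_⟧ r)))
      (≤-trans (both va vb) (m≤m+n (⟦ v , a ⟧ + ⟦ v , b ⟧) (∑ ⟦ v ,_⟧ xs)))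

    cycle : 10 ≤ E C C
    cycle = ∑-≥ {f = λ c → ∑ ⟦ c ,_⟧ C} 2 {C}
      (two u~y₁ u~y₂ (solve 5 (λ u a b d c → (u ⊕ a ⊕ b ⊕ d ⊕ c) ⊜ (b ⊕ d ⊕ u ⊕ a ⊕ c)) ↭-refl [ u ] [ x₁ ] [ y₁ ] [ y₂ ] [ x₂ ]) ∷
       two x₁~y₂ x₁~x₂ (solve 5 (λ u a b d c → (u ⊕ a ⊕ b ⊕ d ⊕ c) ⊜ (d ⊕ c ⊕ u ⊕ a ⊕ b)) ↭-refl [ u ] [ x₁ ] [ y₁ ] [ y₂ ] [ x₂ ]) ∷
       two (~-sym u~y₁) (~-sym x₂~y₁) (solve 5 (λ u a b d c → (u ⊕ a ⊕ b ⊕ d ⊕ c) ⊜ (u ⊕ c ⊕ a ⊕ b ⊕ d)) ↭-refl [ u ] [ x₁ ] [ y₁ ] [ y₂ ] [ x₂ ]) ∷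
       two (~-sym u~y₂) (~-sym x₁~y₂) ↭-refl ∷
       two (~-sym x₁~x₂) x₂~y₁ (solve 5 (λ u a b d c → (u ⊕ a ⊕ b ⊕ d ⊕ c) ⊜ (a ⊕ b ⊕ u ⊕ d ⊕ c)) ↭-refl [ u ] [ x₁ ] [ y₁ ] [ y₂ ] [ x₂ ]) ∷ [])

    edge : ∀ {v a b w z qs} → Part k [ v ] ((a , b) ∷ (w , z) ∷ qs) → v ≁ a → 1 ≤ ⟦ w , v ⟧ + ⟦ w , a ⟧
    edge h va = one≥1 λ wv wa → no-triangle h va (≁-sym wv) (≁-sym wa)

    -- Each of the five cycle edges has an end adjacent to w. Adding these up counts every cycle
    -- vertex twice, so twice the number of neighbours is at least five.
    far : ∀ {w z qs} → Part k [ u ] ((x₁ , y₁) ∷ (x₂ , y₂) ∷ (w , z) ∷ qs) → 3 ≤ ∑ ⟦ w ,_⟧ C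
    far {w} h₀ = half _ (≤-trans
      (+-mono-≤ (edge h₁ ux₁) (+-mono-≤ (edge (reroot h₁ ux₁) y₁x₁) (+-mono-≤ (edge (third₂ (reroot h₀ ux₁)) yy)
        (+-mono-≤ (edge (reroot h₂′ ux₂) y₂x₂) (edge h₂′ ux₂)))))
      (≤-reflexive (eq ⟦ w , u ⟧ ⟦ w , x₁ ⟧ ⟦ w , y₁ ⟧ ⟦ w , y₂ ⟧ ⟦ w , x₂ ⟧)))
      where
      half : ∀ s → 5 ≤ s + s → 3 ≤ s
      half 1 (s≤s (s≤s ()))
      half 2 (s≤s (s≤s (s≤s (s≤s ()))))
      half (suc (suc (suc s))) _ = s≤s (s≤s (s≤s z≤n))
      third : ∀ {v p q r qs} → Part k [ v ] (p ∷ q ∷ r ∷ qs) → Part k [ v ] (p ∷ r ∷ q ∷ qs)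
      third = part-pairs (prep _ (swap _ _ ↭-refl))
      third₂ : ∀ {v p x y r qs} → Part k [ v ] (p ∷ (x , y) ∷ r ∷ qs) → Part k [ v ] ((y , x) ∷ r ∷ p ∷ qs)
      third₂ h = third (part-flip (second-first h))
      h₁ = third h₀
      h₂′ = third (second-first h₀)
      eq : ∀ a b c d e → a + b + (c + b + (c + d + (d + e + (a + e)))) ≡
           (a + (b + (c + (d + (e + 0))))) + (a + (b + (c + (d + (e + 0)))))
      eq = solve-∀

    outside : All (λ w → 3 ≤ ∑ ⟦ w ,_⟧ C) W
    outside = all-flat (all-↭ ps λ r → let h′ = part-pairs (prep _ (prep _ r)) h in
      far h′ , far (part-tail (swap _ _ ↭-refl) refl
        (≁-sym (All.head (All.tail (All.tail (Part.non h′)))) ∷ All.tail (All.tail (All.tail (Part.non h′)))) h′))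

  -- Orient the pairs so that `u` is adjacent to every second end; then `u` misses the first ends of
  -- all pairs but its full pair (a, b). Non-adjacent second ends y, y′ would close the 5-cycle u x
  -- y y′ x′ of the complement, so `u` and these second ends form a (k - 1)-clique.
  one-single-impossible : ∀ {u ps} → 9 ≤ k → Part k [ u ] ps → ⊥
  one-single-impossible {u} {ps₀} 9≤k h₀ = oriented (orient-towards-singles h₀) where
    count : ∀ a b ps → Part k [ u ] ((a , b) ∷ ps) → u ~ a → u ~ b →
            (∀ {x y qs} → ps ↭ (x , y) ∷ qs → u ≁ x) → AllPairs _~_ (u ∷ mates ps) → ⊥
    count a b ps h ua ub far c = 1+n≰n (≤-trans 7≤m (≤-trans m≤2 (s≤s (s≤s z≤n)))) where
      m = length ps
      Q = u ∷ mates ps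
      X = hubs ps
      D = a ∷ b ∷ []
      k≡ : k ≡ 2 + m
      k≡ = sym (Part.size h)
      7≤m : 7 ≤ m
      7≤m = +-cancelˡ-≤ 2 7 m (subst (9 ≤_) k≡ 9≤k)
      |Q| : length Q ≡ 1 + m
      |Q| = cong suc (length-map proj₂ ps)
      |X| : length X ≡ m
      |X| = length-map proj₁ ps
      perm : Q ++ D ++ X ↭ V₀
      perm = ↭-trans (↭-trans
        (solve 5 (λ u a b M X → ((u ⊕ M) ⊕ (a ⊕ b) ⊕ X) ⊜ (u ⊕ a ⊕ b ⊕ X ⊕ M)) ↭-refl [ u ] [ a ] [ b ] (mates ps) X)
        (prep u (prep a (prep b (↭-sym (flat-split ps))))))
        (Part.perm h)

      -- The vertex `u` sends two edges to {a, b}. Every second end y can be made the singleton by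
      -- `reroot`, so it too meets the pair (a, b).
      Q-D : 2 + m ≤ E D Q
      Q-D = subst (2 + m ≤_) (E-sym Q D) (+-mono-≤ {2} {∑ ⟦ u ,_⟧ D} {m}
        (≤-trans (both ua ub) (≤-reflexive (cong (⟦ u , a ⟧ +_) (sym (+-identityʳ ⟦ u , b ⟧)))))
        (≤-trans (≤-reflexive (sym (trans (*-identityʳ _) (length-map proj₂ ps))))
          (∑-≥ 1 (All.map⁺ (all-↭ ps λ r → meets (part-pairs (prep _ r) h) (far r))))))
        where
        meets : ∀ {x y qs} → Part k [ u ] ((a , b) ∷ (x , y) ∷ qs) → u ≁ x → 1 ≤ ∑ ⟦ y ,_⟧ D
        meets {x} {y} h′ ux = subst (1 ≤_) (cong (⟦ y , a ⟧ +_) (sym (+-identityʳ ⟦ y , b ⟧)))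
          (touches≥1 (second-first (reroot (second-first h′) ux)))

      from-Q : E D Q + E X Q ≡ 2 * (1 + m)
      from-Q = begin
        E D Q + E X Q         ≡⟨ E-++ˡ D X Q ⟨
        E (D ++ X) Q          ≡⟨ E-clique-rest perm c (trans k≡ (cong suc (sym |Q|))) ⟩
        length Q + length Q   ≡⟨ cong (λ t → t + t) |Q| ⟩
        1 + m + (1 + m)       ≡⟨ cong ((1 + m) +_) (+-identityʳ (1 + m)) ⟨
        2 * (1 + m)           ∎ where open ≡-Reasoning

      from-D : E D Q + E D X ≤ 2 * (2 + m)
      from-D = begin
        E D Q + E D X             ≤⟨ +-monoʳ-≤ (E D Q) (m≤n+m (E D X) (E D D)) ⟩
        E D Q + (E D D + E D X)   ≡⟨ cong (E D Q +_) (E-++ʳ D D X) ⟨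
        E D Q + E D (D ++ X)      ≡⟨ E-++ʳ D Q (D ++ X) ⟨
        E D (Q ++ D ++ X)         ≡⟨ trans (E-degree D perm) (cong (2 *_) k≡) ⟩
        2 * (2 + m)               ∎ where open ≤-Reasoning

      from-X : E X Q + (E D X + E X X) ≡ m * (2 + m)
      from-X = begin
        E X Q + (E D X + E X X)  ≡⟨ cong (λ t → E X Q + (t + E X X)) (E-sym D X) ⟩
        E X Q + (E X D + E X X)  ≡⟨ cong (E X Q +_) (E-++ʳ X D X) ⟨
        E X Q + E X (D ++ X)     ≡⟨ E-++ʳ X Q (D ++ X) ⟨
        E X (Q ++ D ++ X)        ≡⟨ trans (E-degree X perm) (cong₂ _*_ |X| k≡) ⟩
        m * (2 + m)              ∎ where open ≡-Reasoning

      -- A large E D Q reduces both E X Q and E D X, too far for the m(m - 1) possible adjacencies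
      -- within `X` to make up the degree sum of `X`.
      m≤2 : m ≤ 2
      m≤2 = +-cancelʳ-≤ (m * m + 4 * m + 4) m 2 (begin
        m + (m * m + 4 * m + 4)                                     ≡⟨ eq₁ m ⟩
        m * (2 + m) + m + ((2 + m) + (2 + m))                       ≤⟨ +-mono-≤ (≤-reflexive (cong (_+ m) (sym from-X))) (+-mono-≤ Q-D Q-D) ⟩
        E X Q + (E D X + E X X) + m + (E D Q + E D Q)               ≡⟨ eq₂ (E X Q) (E D X) (E X X) m (E D Q) ⟩
        (E D Q + E X Q) + (E D Q + E D X) + (E X X + m)             ≤⟨ +-mono-≤ (+-mono-≤ (≤-reflexive from-Q) from-D) XX ⟩
        2 * (1 + m) + 2 * (2 + m) + m * m                           ≡⟨ eq₃ m ⟩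
        2 + (m * m + 4 * m + 4)                                     ∎) where
        open ≤-Reasoning
        XX : E X X + m ≤ m * m
        XX = subst (λ t → E X X + t ≤ t * t) |X| (E-self X)
        eq₁ : ∀ m → m + (m * m + 4 * m + 4) ≡ m * (2 + m) + m + ((2 + m) + (2 + m))
        eq₁ = solve-∀
        eq₂ : ∀ a b c m d → a + (b + c) + m + (d + d) ≡ (d + a) + (d + b) + (c + m)
        eq₂ = solve-∀
        eq₃ : ∀ m → 2 * (1 + m) + 2 * (2 + m) + m * m ≡ 2 + (m * m + 4 * m + 4)
        eq₃ = solve-∀

    oriented : (∃ λ qs → flat ps₀ ↭ flat qs × length ps₀ ≡ length qs × Part k [ u ] qs ×
                         All (λ p → All (_~ proj₂ p) [ u ]) qs) → ⊥
    oriented (qs , _ , _ , h , good) = full-pair-exists h λ {a} {b} {ps} r ua ub →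
      let h′ = part-pairs r h
          good′ = All.tail (All-resp-↭ r good)
          far : ∀ {x y qs} → ps ↭ (x , y) ∷ qs → u ≁ x
          far q = force≁ λ ux → one-full-pair (part-pairs (prep _ q) h′) ua ub ux (All.head (All.head (All-resp-↭ q good′)))
      in count a b ps h′ ua ub far (mates-clique ([] ∷ []) good′ λ q _ _ → force~
           (five-cycle-impossible 9≤k
             (part-pairs (↭-trans (prep _ q) (solve 4 (λ a b c d → (a ⊕ b ⊕ c ⊕ d) ⊜ (b ⊕ c ⊕ a ⊕ d)) ↭-refl
               [ _ ] [ _ ] [ _ ] _)) h′)
             (far q) (far (↭-trans q (swap _ _ ↭-refl)))))

  -- `augment` carries the absence of partitions from k classes up to n classes, where the partition
  -- into singletons contradicts it.
  impossible : n < k + k → (suc n ≡ k + k → 9 ≤ k) → ⊥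
  impossible n<2k large = all-unsplittable (proj₁ k≤n) (part (↭-reflexive (++-identityʳ V₀)) []
      (trans (+-identityʳ (length V₀)) (trans |V₀| (sym (proj₂ k≤n)))))
    where
    |V₀| : length V₀ ≡ n
    |V₀| = length-tabulate _
    k≤n : ∃ λ d → k + d ≡ n
    k≤n = m≤n⇒∃[o]m+o≡n (subst (k ≤_) (trans (length-map [_] V₀) |V₀|)
      (partition≥k (map [_] V₀) (↭-reflexive (concat-map-[_] V₀)) (All.map⁺ (All.universal (λ _ → [] ∷ []) V₀))))
    -- A partition into k classes has 2k - n singletons: there is at least one because n < 2k, and
    -- exactly one only for n = 2k - 1.
    unsplittable : Unsplittable k
    unsplittable {[]} {ps} h = <⇒≢ n<2k (trans (sym (part-order h)) (cong (λ t → t + t) (Part.size h)))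
    unsplittable {_ ∷ []} {ps} h = one-single-impossible (large (begin
      suc n                          ≡⟨ cong suc (part-order h) ⟨
      2 + (length ps + length ps)    ≡⟨ cong suc (+-suc (length ps) (length ps)) ⟨
      suc (length ps) + suc (length ps)  ≡⟨ cong (λ t → t + t) (Part.size h) ⟩
      k + k                          ∎)) h where open ≡-Reasoning
    unsplittable {_ ∷ _ ∷ _} h = two-singles-impossible h
    all-unsplittable : ∀ d → Unsplittable (k + d)
    all-unsplittable zero    = subst Unsplittable (sym (+-identityʳ k)) unsplittable
    all-unsplittable (suc d) = subst Unsplittable (sym (+-suc k d))
      (augment n<2k (m≤m+n k d) (all-unsplittable d))

-- From colourings to partitions, and lower bounds on the order

private variable
  n k : ℕ

complete-↭ : {xs : List (Fin n)} → Unique xs → (∀ x → x ∈ xs) → xs ↭ allFin n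
complete-↭ u h = ∼bag⇒↭ (unique∧set⇒bag u (Unique.allFin⁺ _) (mk⇔ (λ _ → ∈-allFin _) (λ _ → h _)))

allPairs-∈ : {R : A → A → Set} → (∀ {x} → R x x) → (∀ {x y} → R x y → R y x) →
             ∀ {xs x y} → AllPairs R xs → x ∈ xs → y ∈ xs → R x y
allPairs-∈ r s (h ∷ hs) (here refl) (here refl) = r
allPairs-∈ r s (h ∷ hs) (here refl) (there q)   = All.lookup h q
allPairs-∈ r s (h ∷ hs) (there p)   (here refl) = s (All.lookup h p)
allPairs-∈ r s (h ∷ hs) (there p)   (there q)   = allPairs-∈ r s hs p q

allPairs-lookup : {R : A → A → Set} {xs : List A} → AllPairs R xs →
                  ∀ {i j} → i Fin.< j → R (lookup xs i) (lookup xs j)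
allPairs-lookup (h ∷ hs) {Fin.zero}  {Fin.suc j} _         = All.lookup h (∈-lookup j)
allPairs-lookup (h ∷ hs) {Fin.suc i} {Fin.suc j} (s≤s i<j) = allPairs-lookup hs i<j

module _ (G : SimpleGraph n) where
  open SimpleGraph G renaming (adj to g; sym to g-sym; irrefl to g-irr)

  partition⇒colourable : ∀ cs → concat cs ↭ allFin n → All (AllPairs λ x y → g x y ≡ false) cs →
                         Colourable g (length cs)
  partition⇒colourable cs p ind = colour , proper where
    class : ∀ x → Any (x ∈_) cs
    class x = ∈-concat⁻ cs (∈-resp-↭ (↭-sym p) (∈-allFin x))
    colour : Fin n → Fin (length cs)
    colour x = Any.index (class x)
    proper : ProperColouring g (length cs) colour
    proper x y xy eq with () ← trans (sym xy) (allPairs-∈ (g-irr _) (λ {a} {b} e → trans (g-sym b a) e)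
      (All.lookup ind (∈-lookup (colour y)))
      (subst (λ i → x ∈ lookup cs i) eq (lookup-index (class x))) (lookup-index (class y)))

  clique≤colours : Colourable g k → ∀ Q → AllPairs (λ x y → g x y ≡ true) Q → length Q ≤ k
  clique≤colours {k} (f , proper) Q c with length Q ≤? k
  ... | yes le = le
  ... | no nle with i , j , i<j , eq ← pigeonhole (≰⇒> nle) (f ∘ lookup Q) =
    ⊥-elim (proper _ _ (allPairs-lookup c i<j) eq)

  module _ {k} (R : IsRChi k k g) where
    private
      open module L = Graph g g-sym g-irr k (proj₁ R)
        (λ cs p ind → ≮⇒≥ λ lt → proj₂ (proj₂ R) _ lt (partition⇒colourable cs p ind)) (clique≤colours (proj₁ (proj₂ R)))
        using (impossible; degree-sum-even)

    order≥2k∸1 : suc n < k + k → ⊥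
    order≥2k∸1 lt = impossible (<-trans (n<1+n n) lt) λ eq → ⊥-elim (<⇒≢ lt eq)

    order≥2k : 3 ≤ k → k ≢ 4 → k ≢ 6 → k ≢ 8 → n < k + k → ⊥
    order≥2k 3≤k ≢4 ≢6 ≢8 lt = impossible lt (9≤k k 3≤k ≢4 ≢6 ≢8 degree-sum-even) where
      not-double : ∀ h d → suc (h + h) ≢ d + d
      not-double (suc h) (suc d) eq rewrite +-suc h h | +-suc d d = not-double h d (suc-injective (suc-injective eq))
      not-double zero    (suc d) eq rewrite +-suc d d with () ← eq
      9≤k : ∀ k′ → 3 ≤ k′ → k′ ≢ 4 → k′ ≢ 6 → k′ ≢ 8 → (∃ λ d → n * k′ ≡ d + d) → suc n ≡ k′ + k′ → 9 ≤ k′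
      -- For n = 2k - 1 the odd degree sums nk are 15 = 1 + 7 + 7, 45 = 1 + 22 + 22 and 91 = 1 + 45
      -- + 45.
      9≤k 3 _ _ _ _ (d , even) refl = ⊥-elim (not-double 7 d even)
      9≤k 4 _ ≢4 _ _ _ _ = ⊥-elim (≢4 refl)
      9≤k 5 _ _ _ _ (d , even) refl = ⊥-elim (not-double 22 d even)
      9≤k 6 _ _ ≢6 _ _ _ = ⊥-elim (≢6 refl)
      9≤k 7 _ _ _ _ (d , even) refl = ⊥-elim (not-double 45 d even)
      9≤k 8 _ _ _ ≢8 _ _ = ⊥-elim (≢8 refl)
      9≤k (suc (suc (suc (suc (suc (suc (suc (suc (suc _))))))))) _ _ _ _ _ _ = m≤m+n 9 _
      9≤k 1 (s≤s ()) _ _ _ _ _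
      9≤k 2 (s≤s (s≤s ())) _ _ _ _ _

-- Cayley graphs

mkGroup : (_∙_ : A → A → A) (ε : A) (_⁻¹ : A → A) → (∀ x y z → (x ∙ y) ∙ z ≡ x ∙ (y ∙ z)) →
          (∀ x → ε ∙ x ≡ x) → (∀ x → x ∙ ε ≡ x) → (∀ x → (x ⁻¹) ∙ x ≡ ε) → (∀ x → x ∙ (x ⁻¹) ≡ ε) →
          IsGroup _≡_ _∙_ ε _⁻¹
mkGroup _∙_ ε _⁻¹ assoc idˡ idʳ invˡ invʳ = record
  { isMonoid = record
    { isSemigroup = record
      { isMagma = record { isEquivalence = isEquivalence ; ∙-cong = cong₂ _∙_ }
      ; assoc = assoc }
    ; identity = idˡ , idʳ }
  ; inverse = invˡ , invʳ
  ; ⁻¹-cong = cong _⁻¹ }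

module _ (C : CayleyData n) where
  open CayleyData C
  private
    module I = IsGroup isGroup
    group : Group _ _
    group = record { isGroup = isGroup }
    module P = GroupProperties group

  cayleyGraph : SimpleGraph n
  cayleyGraph = record
    { adj    = cayAdj
    ; sym    = λ x y → trans (sym (S-inv ((x ⁻¹) ∙ y)))
        (cong S (trans (P.⁻¹-anti-homo-∙ (x ⁻¹) y) (cong ((y ⁻¹) ∙_) (P.⁻¹-involutive x))))
    ; irrefl = λ x → trans (cong S (I.inverseˡ x)) S-ε }

  -- Left translation by `v` permutes the group and carries the connection set onto the neighbours
  -- of `v`.
  degree-cayley : ∀ v → degree cayAdj v ≡ ∑ (λ z → if S z then 1 else 0) (allFin n)
  degree-cayley v = begin
    ∑ (λ w → if S ((v ⁻¹) ∙ w) then 1 else 0) (allFin n)            ≡⟨ ∑-↭ _ translate ⟨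
    ∑ (λ w → if S ((v ⁻¹) ∙ w) then 1 else 0) (map (v ∙_) (allFin n)) ≡⟨ ∑-map _ (v ∙_) (allFin n) ⟩
    ∑ (λ z → if S ((v ⁻¹) ∙ (v ∙ z)) then 1 else 0) (allFin n)      ≡⟨ ∑-cong (All.universal (λ z →
                                                                         cong (λ t → if S t then 1 else 0) (P.\\-leftDividesʳ v z)) (allFin n)) ⟩
    ∑ (λ z → if S z then 1 else 0) (allFin n)                        ∎
    where
    open ≡-Reasoning
    translate : map (v ∙_) (allFin n) ↭ allFin n
    translate = complete-↭ (Unique.map⁺ (λ {x} {y} → P.∙-cancelˡ v x y) (Unique.allFin⁺ n))
      λ x → subst (_∈ map (v ∙_) (allFin n)) (P.\\-leftDividesˡ v x) (∈-map⁺ (v ∙_) (∈-allFin ((v ⁻¹) ∙ x)))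

-- Cyclic groups

module Cyclic (m : ℕ) where
  N = suc m

  infixl 6 _⊕_
  _⊕_ : Fin N → Fin N → Fin N
  x ⊕ y = (toℕ x + toℕ y) mod N

  ⊖_ : Fin N → Fin N
  ⊖ x = (N ∸ toℕ x) mod N

  toℕ-mod : ∀ a → toℕ (a mod N) ≡ a % N
  toℕ-mod a = toℕ-fromℕ< (m%n<n a N)

  %-+ˡ : ∀ a b → (a % N + b) % N ≡ (a + b) % N
  %-+ˡ a b = begin
    (a % N + b) % N               ≡⟨ %-distribˡ-+ (a % N) b N ⟩
    (a % N % N + b % N) % N       ≡⟨ cong (λ t → (t + b % N) % N) (m%n%n≡m%n a N) ⟩
    (a % N + b % N) % N           ≡⟨ %-distribˡ-+ a b N ⟨
    (a + b) % N                   ∎ where open ≡-Reasoning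

  ⊕-comm : ∀ x y → x ⊕ y ≡ y ⊕ x
  ⊕-comm x y = cong (_mod N) (+-comm (toℕ x) (toℕ y))

  toℕ-⊕ˡ : ∀ a y → toℕ (a mod N ⊕ y) ≡ (a + toℕ y) % N
  toℕ-⊕ˡ a y = trans (toℕ-mod (toℕ (a mod N) + toℕ y)) (trans (cong (λ t → (t + toℕ y) % N) (toℕ-mod a)) (%-+ˡ a (toℕ y)))

  ⊕-assoc : ∀ x y z → (x ⊕ y) ⊕ z ≡ x ⊕ (y ⊕ z)
  ⊕-assoc x y z = toℕ-injective (begin
    toℕ ((x ⊕ y) ⊕ z)                  ≡⟨ toℕ-⊕ˡ (toℕ x + toℕ y) z ⟩
    (toℕ x + toℕ y + toℕ z) % N        ≡⟨ cong (_% N) (rotate (toℕ x) (toℕ y) (toℕ z)) ⟩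
    (toℕ y + toℕ z + toℕ x) % N        ≡⟨ toℕ-⊕ˡ (toℕ y + toℕ z) x ⟨
    toℕ ((y ⊕ z) ⊕ x)                  ≡⟨ cong toℕ (⊕-comm (y ⊕ z) x) ⟩
    toℕ (x ⊕ (y ⊕ z))                  ∎) where
    open ≡-Reasoning
    rotate : ∀ a b c → a + b + c ≡ b + c + a
    rotate = solve-∀

  ⊕-identityˡ : ∀ x → Fin.zero ⊕ x ≡ x
  ⊕-identityˡ x = toℕ-injective (trans (toℕ-mod (toℕ x)) (m<n⇒m%n≡m (toℕ<n x)))

  ⊕-inverseˡ : ∀ x → ⊖ x ⊕ x ≡ Fin.zero
  ⊕-inverseˡ x = toℕ-injective (begin
    toℕ (⊖ x ⊕ x)                ≡⟨ toℕ-⊕ˡ (N ∸ toℕ x) x ⟩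
    (N ∸ toℕ x + toℕ x) % N      ≡⟨ cong (_% N) (m∸n+n≡m (<⇒≤ (toℕ<n x))) ⟩
    N % N                        ≡⟨ n%n≡0 N ⟩
    0                            ∎) where open ≡-Reasoning

  isGroup : IsGroup _≡_ _⊕_ Fin.zero ⊖_
  isGroup = mkGroup _⊕_ Fin.zero ⊖_ ⊕-assoc ⊕-identityˡ (λ x → trans (⊕-comm x _) (⊕-identityˡ x))
    ⊕-inverseˡ (λ x → trans (⊕-comm x _) (⊕-inverseˡ x))

  group : Group _ _
  group = record { isGroup = isGroup }

-- Three vertices of one colour

module _ {c} (f : Fin n → Fin c) where
  private
    Earlier : Fin n → Set
    Earlier v = ∃ λ w → w Fin.< v × f w ≡ f v

    earlier? : ∀ v → Dec (Earlier v)
    earlier? v = any? λ w → (w Fin.<? v) ×-dec (f w Fin.≟ f v)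

    flag : Fin n → Fin 2
    flag v = if does (earlier? v) then Fin.suc Fin.zero else Fin.zero

    flag-resp : ∀ {u v} → flag u ≡ flag v → Earlier v → Earlier u
    flag-resp {u} {v} eq e with earlier? u | earlier? v
    ... | yes e′ | _      = e′
    ... | no _   | no ne  = ⊥-elim (ne e)
    ... | no _   | yes _ with () ← eq

  -- Two vertices agreeing in colour and in whether the colour occurred before yield a third one.
  three-pigeons : c * 2 < n → ∃ λ i → ∃₂ λ j l → i Fin.< j × j Fin.< l × f i ≡ f j × f j ≡ f l
  three-pigeons lt with j , l , j<l , eq ← pigeonhole lt (λ v → combine (f v) (flag v))
    with fj≡fl , flags ← combine-injective (f j) (flag j) (f l) (flag l) eq
    with i , i<j , fi≡fj ← flag-resp flags (j , j<l , fj≡fl) = i , j , l , i<j , j<l , fi≡fj , fj≡fl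

-- The prism over a complete graph

module Prism (m : ℕ) where
  k₀ = suc (suc m)
  module ℤ₂ = Cyclic 1
  module ℤₖ = Cyclic (suc m)
  open ℤₖ using (_⊕_; ⊖_)

  V : Set
  V = Fin (2 * k₀)

  abstract
    join : Fin 2 × Fin k₀ → V
    join (b , i) = combine b i

    split : V → Fin 2 × Fin k₀
    split = remQuot k₀

    split-join : ∀ p → split (join p) ≡ p
    split-join (b , i) = remQuot-combine b i

    join-split : ∀ x → join (split x) ≡ x
    join-split = combine-remQuot {2} k₀

  join-injective : ∀ {p q} → join p ≡ join q → p ≡ q
  join-injective {p} {q} e = trans (sym (split-join p)) (trans (cong split e) (split-join q))

  infixl 6 _⊞_
  _⊞_ : Fin 2 × Fin k₀ → Fin 2 × Fin k₀ → Fin 2 × Fin k₀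
  (b , i) ⊞ (c , j) = b ℤ₂.⊕ c , i ⊕ j

  ⊟_ : Fin 2 × Fin k₀ → Fin 2 × Fin k₀
  ⊟ (b , i) = ℤ₂.⊖ b , ⊖ i

  0# : Fin 2 × Fin k₀
  0# = Fin.zero , Fin.zero

  _∙_ : V → V → V
  x ∙ y = join (split x ⊞ split y)

  _⁻¹ : V → V
  x ⁻¹ = join (⊟ split x)

  isGroup : IsGroup _≡_ _∙_ (join 0#) _⁻¹
  isGroup = mkGroup _∙_ (join 0#) _⁻¹ assoc idˡ (λ x → trans (comm x (join 0#)) (idˡ x)) invˡ (λ x → trans (comm x (x ⁻¹)) (invˡ x))
    where
    comm : ∀ x y → x ∙ y ≡ y ∙ x
    comm x y = cong join (cong₂ _,_ (ℤ₂.⊕-comm (proj₁ (split x)) (proj₁ (split y))) (ℤₖ.⊕-comm (proj₂ (split x)) (proj₂ (split y))))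
    assoc : ∀ x y z → (x ∙ y) ∙ z ≡ x ∙ (y ∙ z)
    assoc x y z = cong join (trans (cong (_⊞ split z) (split-join (split x ⊞ split y))) (trans
      (cong₂ _,_ (ℤ₂.⊕-assoc (proj₁ (split x)) (proj₁ (split y)) (proj₁ (split z)))
                 (ℤₖ.⊕-assoc (proj₂ (split x)) (proj₂ (split y)) (proj₂ (split z))))
      (cong (split x ⊞_) (sym (split-join (split y ⊞ split z))))))
    idˡ : ∀ x → join 0# ∙ x ≡ x
    idˡ x = trans (cong (λ t → join (t ⊞ split x)) (split-join 0#)) (trans
      (cong join (cong₂ _,_ (ℤ₂.⊕-identityˡ (proj₁ (split x))) (ℤₖ.⊕-identityˡ (proj₂ (split x))))) (join-split x))
    invˡ : ∀ x → (x ⁻¹) ∙ x ≡ join 0#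
    invˡ x = cong join (trans (cong (_⊞ split x) (split-join (⊟ split x)))
      (cong₂ _,_ (ℤ₂.⊕-inverseˡ (proj₁ (split x))) (ℤₖ.⊕-inverseˡ (proj₂ (split x)))))

  -- The non-zero elements of the second factor make each layer a complete graph; the involution of
  -- the first factor matches the two layers.
  generator : Fin 2 × Fin k₀ → Bool
  generator (Fin.zero  , Fin.zero)  = false
  generator (Fin.zero  , Fin.suc _) = true
  generator (Fin.suc _ , Fin.zero)  = true
  generator (Fin.suc _ , Fin.suc _) = false

  private
    module Pₖ = GroupProperties ℤₖ.group

    ⊖0≡0 : ⊖ Fin.zero ≡ Fin.zero
    ⊖0≡0 = Pₖ.ε⁻¹≈ε

    ⊖-nonzero : ∀ i → ∃ λ j → ⊖ (Fin.suc i) ≡ Fin.suc j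
    ⊖-nonzero i with ⊖ (Fin.suc i) in eq
    ... | Fin.suc j = j , refl
    ... | Fin.zero with () ← trans (sym (Pₖ.⁻¹-involutive (Fin.suc i))) (trans (cong ⊖_ eq) ⊖0≡0)

    generator-⊟ : ∀ p → generator (⊟ p) ≡ generator p
    generator-⊟ (Fin.zero , Fin.zero) rewrite ⊖0≡0 = refl
    generator-⊟ (Fin.zero , Fin.suc i) with j , eq ← ⊖-nonzero i rewrite eq = refl
    generator-⊟ (Fin.suc Fin.zero , Fin.zero) rewrite ⊖0≡0 = refl
    generator-⊟ (Fin.suc Fin.zero , Fin.suc i) with j , eq ← ⊖-nonzero i rewrite eq = refl

  prism : CayleyData (2 * k₀)
  prism = record
    { _∙_ = _∙_ ; ε = join 0# ; _⁻¹ = _⁻¹ ; isGroup = isGroup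
    ; S = λ x → generator (split x)
    ; S-ε = cong generator (split-join 0#)
    ; S-inv = λ x → trans (cong generator (split-join (⊟ split x))) (generator-⊟ (split x)) }

  open CayleyData prism using (cayAdj)

  adj≡ : ∀ x y → cayAdj x y ≡ generator ((⊟ split x) ⊞ split y)
  adj≡ x y = cong generator (trans (split-join _) (cong (_⊞ split y) (split-join (⊟ split x))))

  -- The connection set is counted by columns: over each residue i exactly one of the two elements
  -- is a generator.
  regular : Regular cayAdj k₀
  regular v = trans (degree-cayley prism v) (begin
    ∑ h (allFin (2 * k₀))                       ≡⟨ ∑-↭ h layers ⟨
    ∑ h (layer Fin.zero ++ layer (Fin.suc Fin.zero))      ≡⟨ ∑-++ h (layer Fin.zero) (layer (Fin.suc Fin.zero)) ⟩
    ∑ h (layer Fin.zero) + ∑ h (layer (Fin.suc Fin.zero)) ≡⟨ cong₂ _+_ (∑-map h (λ i → join (Fin.zero , i)) (allFin k₀)) (∑-map h (λ i → join (Fin.suc Fin.zero , i)) (allFin k₀)) ⟩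
    ∑ (λ i → h (join (Fin.zero , i))) (allFin k₀) + ∑ (λ i → h (join (Fin.suc Fin.zero , i))) (allFin k₀)
                                                ≡⟨ ∑-+ (λ i → h (join (Fin.zero , i))) (λ i → h (join (Fin.suc Fin.zero , i))) (allFin k₀) ⟨
    ∑ (λ i → h (join (Fin.zero , i)) + h (join (Fin.suc Fin.zero , i))) (allFin k₀)
                                                ≡⟨ ∑-cong (All.universal one (allFin k₀)) ⟩
    ∑ (λ _ → 1) (allFin k₀)                     ≡⟨ ∑-const 1 (allFin k₀) ⟩
    length (allFin k₀) * 1                      ≡⟨ trans (*-identityʳ _) (length-tabulate {n = k₀} (λ i → i)) ⟩
    k₀                                          ∎)
    where
    open ≡-Reasoning
    h : V → ℕ
    h z = if generator (split z) then 1 else 0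
    layer : Fin 2 → List V
    layer b = map (λ i → join (b , i)) (allFin k₀)
    one : ∀ i → h (join (Fin.zero , i)) + h (join (Fin.suc Fin.zero , i)) ≡ 1
    one i rewrite split-join (Fin.zero , i) | split-join (Fin.suc Fin.zero , i) with i
    ... | Fin.zero  = refl
    ... | Fin.suc _ = refl
    layer-unique : ∀ b → Unique (layer b)
    layer-unique b = Unique.map⁺ (λ e → cong proj₂ (join-injective e)) (Unique.allFin⁺ k₀)
    disjoint : ∀ {x} → x ∈ layer Fin.zero × x ∈ layer (Fin.suc Fin.zero) → ⊥
    disjoint (p , q) with _ , _ , e ← ∈-map⁻ _ p with _ , _ , e′ ← ∈-map⁻ _ q
      with () ← cong proj₁ (join-injective (trans (sym e) e′))
    in-layer : ∀ p → join p ∈ layer Fin.zero ++ layer (Fin.suc Fin.zero)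
    in-layer (Fin.zero , i)          = ∈-++⁺ˡ (∈-map⁺ (λ i → join (Fin.zero , i)) (∈-allFin i))
    in-layer (Fin.suc Fin.zero , i)  = ∈-++⁺ʳ (layer Fin.zero) (∈-map⁺ (λ i → join (Fin.suc Fin.zero , i)) (∈-allFin i))
    layers : layer Fin.zero ++ layer (Fin.suc Fin.zero) ↭ allFin (2 * k₀)
    layers = complete-↭ (Unique.++⁺ (layer-unique Fin.zero) (layer-unique (Fin.suc Fin.zero)) disjoint)
      λ x → subst (_∈ _) (join-split x) (in-layer (split x))

  -- The shift on the second layer separates the ends of each matching edge, and within a layer all
  -- colours differ.
  colour : Fin 2 × Fin k₀ → Fin k₀
  colour (Fin.zero  , i) = i
  colour (Fin.suc _ , i) = i ⊕ Fin.suc Fin.zero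

  private
    one≢zero : ∀ j → j ⊕ Fin.suc Fin.zero ≢ j
    one≢zero j eq with () ← Pₖ.identityʳ-unique j (Fin.suc Fin.zero) eq

    other-layer : ∀ {b i j} → generator (Fin.suc b , (⊖ i) ⊕ j) ≡ true → i ≡ j
    other-layer {b} {i} {j} adj with (⊖ i) ⊕ j in eq
    ... | Fin.zero = sym (trans (Pₖ.inverseʳ-unique (⊖ i) j eq) (Pₖ.⁻¹-involutive i))

    same-layer : ∀ i → generator (Fin.zero , (⊖ i) ⊕ i) ≢ true
    same-layer i adj rewrite ℤₖ.⊕-inverseˡ i with () ← adj

  proper : ∀ p q → generator ((⊟ p) ⊞ q) ≡ true → colour p ≢ colour q
  proper (Fin.zero , i) (Fin.zero , j) adj refl = same-layer i adj
  proper (Fin.suc Fin.zero , i) (Fin.suc Fin.zero , j) adj eq with refl ← Pₖ.∙-cancelʳ (Fin.suc Fin.zero) i j eq = same-layer i adj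
  proper (Fin.zero , i) (Fin.suc Fin.zero , j) adj eq with refl ← other-layer {i = i} {j} adj = one≢zero i (sym eq)
  proper (Fin.suc Fin.zero , i) (Fin.zero , j) adj eq with refl ← other-layer {i = i} {j} adj = one≢zero i eq

  colourable : Colourable cayAdj k₀
  colourable = (λ x → colour (split x)) , λ x y adj → proper (split x) (split y) (trans (sym (adj≡ x y)) adj)

  layer-adjacent : ∀ i j → i ≢ j → cayAdj (join (Fin.zero , i)) (join (Fin.zero , j)) ≡ true
  layer-adjacent i j i≢j = trans (adj≡ _ _)
    (trans (cong₂ (λ p q → generator ((⊟ p) ⊞ q)) (split-join (Fin.zero , i)) (split-join (Fin.zero , j))) nonzero)
    where
    nonzero : generator (Fin.zero , (⊖ i) ⊕ j) ≡ true
    nonzero with (⊖ i) ⊕ j in eq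
    ... | Fin.suc _ = refl
    ... | Fin.zero  = ⊥-elim (i≢j (sym (trans (Pₖ.inverseʳ-unique (⊖ i) j eq) (Pₖ.⁻¹-involutive i))))

  hasCayley : HasCayleyRChiGraph k₀ k₀ (2 * k₀)
  hasCayley = prism , regular , colourable , λ c lt (f , f-proper) →
    let i , j , i<j , eq = pigeonhole lt (λ i → f (join (Fin.zero , i)))
    in f-proper _ _ (layer-adjacent i j (Fin.<⇒≢ i<j)) eq

-- Circulants of order 2k - 1

module Circulant (c : ℕ) (T : Fin (suc (c * 2)) → Bool) (T-0 : T Fin.zero ≡ false)
  (T-⊖ : ∀ x → T (Cyclic.⊖_ (c * 2) x) ≡ T x) where
  open Cyclic (c * 2)

  circulant : CayleyData N
  circulant = record { _∙_ = _⊕_ ; ε = Fin.zero ; _⁻¹ = ⊖_ ; isGroup = isGroup ; S = T ; S-ε = T-0 ; S-inv = T-⊖ }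

  open CayleyData circulant using (cayAdj)

  -- The classes are {0, 1}, {2, 3} and so on, with the last residue alone: a near-perfect matching
  -- of the complement.
  halve : Fin N → Fin (suc c)
  halve x = (toℕ x / 2) mod suc c

  -- With at most c colours on 2c + 1 vertices some colour occurs three times, whereas `no-three`
  -- excludes three independent vertices.
  hasCayley : ∑ (λ z → if T z then 1 else 0) (allFin N) ≡ suc c → ProperColouring cayAdj (suc c) halve →
              (∀ i j l → i Fin.< j → j Fin.< l → cayAdj i j ≡ false → cayAdj j l ≡ false → cayAdj i l ≡ true) →
              HasCayleyRChiGraph (suc c) (suc c) N
  hasCayley deg proper no-three = circulant , (λ v → trans (degree-cayley circulant v) deg) , (halve , proper) ,
    λ c′ c′≤c (f , f-proper) →
      let i , j , l , i<j , j<l , ij , jl = three-pigeons f (s≤s (*-monoˡ-≤ 2 (≤-pred c′≤c)))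
          nonadj : ∀ {x y} → f x ≡ f y → cayAdj x y ≡ false
          nonadj eq = Bool.¬-not λ adj → f-proper _ _ adj eq
      in f-proper i l (no-three i j l i<j j<l (nonadj ij) (nonadj jl)) (trans ij jl)

avoiding : List ℕ → Fin n → Bool
avoiding xs x = not (any (toℕ x ≡ᵇ_) xs)

-- Joining the avoided residues instead gives triangle-free graphs with a near-perfect matching:
-- the cycle C₇, the Andrásfai graph on 11 vertices and the threefold blow-up of C₅.
seven : HasCayleyRChiGraph 4 4 7
seven = hasCayley refl proper no-three where
  T = avoiding (0 ∷ 1 ∷ 6 ∷ [])
  open Circulant 3 T refl (from-yes (all? λ x → T (Cyclic.⊖_ 6 x) Bool.≟ T x))
  open CayleyData circulant using (cayAdj)
  abstract
    proper : ProperColouring cayAdj 4 halve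
    proper = from-yes (all? λ x → all? λ y → (cayAdj x y Bool.≟ true) →-dec ¬? (halve x Fin.≟ halve y))
    no-three : ∀ i j l → i Fin.< j → j Fin.< l → cayAdj i j ≡ false → cayAdj j l ≡ false → cayAdj i l ≡ true
    no-three = from-yes (all? λ i → all? λ j → all? λ l → (i Fin.<? j) →-dec ((j Fin.<? l) →-dec
      ((cayAdj i j Bool.≟ false) →-dec ((cayAdj j l Bool.≟ false) →-dec (cayAdj i l Bool.≟ true)))))

eleven : HasCayleyRChiGraph 6 6 11
eleven = hasCayley refl proper no-three where
  -- Apart from 0, the avoided residues are those congruent to 1 modulo 3, a set closed under
  -- negation modulo 11.
  T = avoiding (0 ∷ 1 ∷ 4 ∷ 7 ∷ 10 ∷ [])
  open Circulant 5 T refl (from-yes (all? λ x → T (Cyclic.⊖_ 10 x) Bool.≟ T x))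
  open CayleyData circulant using (cayAdj)
  abstract
    proper : ProperColouring cayAdj 6 halve
    proper = from-yes (all? λ x → all? λ y → (cayAdj x y Bool.≟ true) →-dec ¬? (halve x Fin.≟ halve y))
    no-three : ∀ i j l → i Fin.< j → j Fin.< l → cayAdj i j ≡ false → cayAdj j l ≡ false → cayAdj i l ≡ true
    no-three = from-yes (all? λ i → all? λ j → all? λ l → (i Fin.<? j) →-dec ((j Fin.<? l) →-dec
      ((cayAdj i j Bool.≟ false) →-dec ((cayAdj j l Bool.≟ false) →-dec (cayAdj i l Bool.≟ true)))))

fifteen : HasCayleyRChiGraph 8 8 15
fifteen = hasCayley refl proper no-three where
  -- Apart from 0, the avoided residues are those congruent to 1 or 4 modulo 5.
  T = avoiding (0 ∷ 1 ∷ 4 ∷ 6 ∷ 9 ∷ 11 ∷ 14 ∷ [])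
  open Circulant 7 T refl (from-yes (all? λ x → T (Cyclic.⊖_ 14 x) Bool.≟ T x))
  open CayleyData circulant using (cayAdj)
  abstract
    proper : ProperColouring cayAdj 8 halve
    proper = from-yes (all? λ x → all? λ y → (cayAdj x y Bool.≟ true) →-dec ¬? (halve x Fin.≟ halve y))
    no-three : ∀ i j l → i Fin.< j → j Fin.< l → cayAdj i j ≡ false → cayAdj j l ≡ false → cayAdj i l ≡ true
    no-three = from-yes (all? λ i → all? λ j → all? λ l → (i Fin.<? j) →-dec ((j Fin.<? l) →-dec
      ((cayAdj i j Bool.≟ false) →-dec ((cayAdj j l Bool.≟ false) →-dec (cayAdj i l Bool.≟ true)))))

-- Exact values

prism-exists : ∀ k → 3 ≤ k → HasCayleyRChiGraph k k (2 * k)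
prism-exists (suc (suc m)) _ = Prism.hasCayley m
prism-exists 1 (s≤s ())

-- A Cayley graph attaining a lower bound valid for all graphs settles both minima at once.
exact : ∀ {k N} → HasCayleyRChiGraph k k N → (∀ {m} (G : SimpleGraph m) → IsRChi k k (SimpleGraph.adj G) → m < N → ⊥) →
        nRChi≡ k k N × cRChi≡ k k N
exact h@(C , r) none = ((cayleyGraph C , r) , λ m lt (G , r′) → none G r′ lt) ,
                       (h , λ m lt (C′ , r′) → none (cayleyGraph C′) r′ lt)

exact-2k : ∀ {k} → 3 ≤ k → k ≢ 4 → k ≢ 6 → k ≢ 8 → nRChi≡ k k (2 * k) × cRChi≡ k k (2 * k)
exact-2k {k} 3≤k ≢4 ≢6 ≢8 = exact (prism-exists k 3≤k) λ G r lt →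
  order≥2k G r 3≤k ≢4 ≢6 ≢8 (<-≤-trans lt (≤-reflexive (cong (k +_) (+-identityʳ k))))

exact-2k∸1 : ∀ {k N} → suc N ≡ k + k → HasCayleyRChiGraph k k N → nRChi≡ k k N × cRChi≡ k k N
exact-2k∸1 eq h = exact h λ G r lt → order≥2k∸1 G r (<-≤-trans (s≤s lt) (≤-reflexive eq))

theorem6 : ((k : ℕ) → 3 ≤ k →
    ¬ (k ≡ 4 ⊎ k ≡ 6 ⊎ k ≡ 8 ⊎ k ≡ 10 ⊎ k ≡ 12) →
    nRChi≡ k k (2 * k) × cRChi≡ k k (2 * k))
    × (nRChi≡ 4 4 7 × cRChi≡ 4 4 7)
    × ((k : ℕ) → (k ≡ 6 ⊎ k ≡ 8 ⊎ k ≡ 10 ⊎ k ≡ 12) →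
    Σ ℕ (λ a → Σ ℕ (λ b →
    nRChi≡ k k a × cRChi≡ k k b
    × 2 * k ∸ 1 ≤ a × a ≤ b × b ≤ 2 * k)))
theorem6 = generic , exact-2k∸1 refl seven , exceptional where
  generic : ∀ k → 3 ≤ k → ¬ (k ≡ 4 ⊎ k ≡ 6 ⊎ k ≡ 8 ⊎ k ≡ 10 ⊎ k ≡ 12) → nRChi≡ k k (2 * k) × cRChi≡ k k (2 * k)
  generic k 3≤k h = exact-2k 3≤k (h ∘ inj₁) (h ∘ inj₂ ∘ inj₁) (h ∘ inj₂ ∘ inj₂ ∘ inj₁)

  Bounded : ℕ → Set
  Bounded k = Σ ℕ λ a → Σ ℕ λ b → nRChi≡ k k a × cRChi≡ k k b × 2 * k ∸ 1 ≤ a × a ≤ b × b ≤ 2 * k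

  bounded : ∀ {k} N → nRChi≡ k k N × cRChi≡ k k N → 2 * k ∸ 1 ≤ N → N ≤ 2 * k → Bounded k
  bounded N (eₙ , e′) lo hi = N , N , eₙ , e′ , lo , ≤-refl , hi

  exceptional : ∀ k → (k ≡ 6 ⊎ k ≡ 8 ⊎ k ≡ 10 ⊎ k ≡ 12) → Bounded k
  -- In each case both minima are known exactly and agree: 2k - 1 for k = 6, 8 and 2k for k = 10,
  -- 12.
  exceptional _ (inj₁ refl)                 = bounded 11 (exact-2k∸1 refl eleven) ≤-refl (n≤1+n 11)
  exceptional _ (inj₂ (inj₁ refl))          = bounded 15 (exact-2k∸1 refl fifteen) ≤-refl (n≤1+n 15)
  exceptional _ (inj₂ (inj₂ (inj₁ refl)))   = bounded 20 (exact-2k (m≤m+n 3 7) (λ ()) (λ ()) (λ ())) (n≤1+n 19) ≤-refl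
  exceptional _ (inj₂ (inj₂ (inj₂ refl)))   = bounded 24 (exact-2k (m≤m+n 3 9) (λ ()) (λ ()) (λ ())) (n≤1+n 23) ≤-refl
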